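{- Let $k\ge 3$ be an integer, $p=1-\frac1k$ and $\lambda=\frac{1}{10}-\frac{1}{2k}+\frac{1}{k^2}-\frac{1}{k^3}+\frac{2}{5k^4}$. For every real $\delta>0$ there is $\epsilon>0$ such that every graph $G$ with $n\ge 1/\epsilon$ vertices, at least $(p-\epsilon)\binom n2$ edges and at most $(\lambda+\epsilon)n^5$ copies of $C_5$ is within edit distance $\delta n^2$ from the Turán graph $T_k^n$.
   Context: A copy of $C_5$ in $G$ is a (not necessarily induced) subgraph of $G$ isomorphic to the $5$-cycle. The Turán graph $T_k^n$ is the complete $k$-partite graph on $n$ vertices with part sizes as equal as possible. The edit distance between two graphs on the same $n$-vertex set is the minimum number of adjacencies that must be changed (edges added or removed) in one to obtain a graph isomorphic to the other. -}

module Defs where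

open import Data.Nat as ℕ using (ℕ; zero; suc; _%_)
open import Data.Nat.Properties using () renaming (_≟_ to _≟ℕ_)
open import Data.Integer using (+_)
open import Data.Rational using (ℚ; _/_; _*_; _+_; _-_; 1ℚ; _≤_)
open import Data.Fin using (Fin; toℕ; _<?_)
open import Data.Bool using (Bool; true; false; _∧_; not; if_then_else_)
open import Data.List using (List; []; _∷_; length; filter; allFin; concatMap; map)
open import Data.Product using (_×_; _,_; Σ; ∃)
open import Relation.Binary.PropositionalEquality using (_≡_)
open import Relation.Nullary.Decidable using (does; ⌊_⌋)

open import Function.Bundles using (_↔_; Inverse)
open import Function using (_∘_)

record Graph (n : ℕ) : Set where
  field
    adj    : Fin n → Fin n → Bool
    sym    : ∀ i j → adj i j ≡ adj j i
    irrefl : ∀ i → adj i i ≡ false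
open Graph public

ℕtoℚ : ℕ → ℚ
ℕtoℚ n = + n / 1

-- 1/k as a rational (only used for k ≥ 3)
recipℕ : ℕ → ℚ
recipℕ zero    = + 0 / 1
recipℕ (suc m) = + 1 / suc m

pairs : (n : ℕ) → List (Fin n × Fin n)
pairs n = concatMap (λ i → map (λ j → i , j) (filter (λ j → i <? j) (allFin n))) (allFin n)

edges : ∀ {n} → Graph n → ℕ
edges {n} G = length (filter (λ { (i , j) → adj G i j Data.Bool.≟ true }) (pairs n))
  where import Data.Bool

choose2ℚ : ℕ → ℚ
choose2ℚ n = + (n ℕ.* (n ℕ.∸ 1)) / 2

private
  distinct : ∀ {n} → List (Fin n) → Bool
  distinct []       = true
  distinct (x ∷ xs) = not (anyEq x xs) ∧ distinct xs
    where
      anyEq : ∀ {n} → Fin n → List (Fin n) → Bool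
      anyEq x []       = false
      anyEq x (y ∷ ys) = does (x Data.Fin.≟ y) Data.Bool.∨ anyEq x ys
        where import Data.Bool

tuples5 : (n : ℕ) → List (Fin n × Fin n × Fin n × Fin n × Fin n)
tuples5 n =
  concatMap (λ a → concatMap (λ b → concatMap (λ c → concatMap (λ d →
    map (λ e → a , b , c , d , e) (allFin n)) (allFin n)) (allFin n)) (allFin n)) (allFin n)

isLabelledC5 : ∀ {n} → Graph n → Fin n × Fin n × Fin n × Fin n × Fin n → Bool
isLabelledC5 G (a , b , c , d , e) =
  distinct (a ∷ b ∷ c ∷ d ∷ e ∷ [])
  ∧ adj G a b ∧ adj G b c ∧ adj G c d ∧ adj G d e ∧ adj G e a

labelledC5 : ∀ {n} → Graph n → ℕ
labelledC5 {n} G = length (filter (λ t → isLabelledC5 G t Data.Bool.≟ true) (tuples5 n))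
  where import Data.Bool

-- number of copies of C5 in G (subgraphs isomorphic to C5): each copy
-- corresponds to exactly |Aut(C5)| = 10 labelled copies.
copiesC5 : ∀ {n} → Graph n → ℕ
copiesC5 G = labelledC5 G ℕ./ 10

-- Turán graph T_k^n on Fin n: vertex i lies in part (i mod k); parts have
-- sizes as equal as possible; two vertices adjacent iff in different parts.
turanAdj : (k n : ℕ) → Fin n → Fin n → Bool
turanAdj zero    n i j = false
turanAdj (suc m) n i j = not (does (toℕ i % suc m ≟ℕ toℕ j % suc m))

mismatch : ∀ {n} → Graph n → (Fin n → Fin n → Bool) → (Fin n → Fin n) → ℕ
mismatch {n} G H σ =
  length (filter (λ { (i , j) → adj G i j Data.Bool.≟ not (H (σ i) (σ j)) }) (pairs n))
  where import Data.Bool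

withinEditDistTuran : ∀ {n} → (k : ℕ) → Graph n → ℚ → Set
withinEditDistTuran {n} k G d =
  Σ (Fin n ↔ Fin n) λ σ → ℕtoℚ (mismatch G (turanAdj k n) (Inverse.to σ)) ≤ d

{-# OPTIONS --safe #-}

-- Let A be the adjacency matrix, B = J − A that of the complement with loops, and
-- d, u = A d the vectors of 1- and 2-walk counts.  Expanding the number X of 4-walks
-- of B between A-adjacent vertices expresses the number of closed 5-walks of A as X
-- plus a polynomial in the path counts, 4|u|² − 3n⟨d,u⟩ + ….  Cauchy–Schwarz applied
-- to 8u − 3nd and to d bounds this polynomial below by a convex quartic in the edge
-- density p, p(2p−1)(2p²−2p+1), plus a multiple of the variance of d; the tangent of
-- the quartic at p = 1 − 1/k is increasing.  Hence under the hypotheses X and the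
-- variance are small and p is close to 1 − 1/k, that is, almost all degrees of B are
-- close to n/k.  Two more applications of Cauchy–Schwarz turn the bound on X into
-- one on the induced cherries of B.  A graph with few induced cherries and almost all
-- degrees near n/k splits greedily into k near-cliques of size near n/k: in each round
-- an average unclustered vertex has a neighbourhood that can be cut off cheaply.  A
-- bijection onto the Turán graph that no transposition improves then misplaces few
-- vertices.

module Submission where

-- The lower bound on closed 5-walks is asymptotically attained by the Turán graph. There `d` and
-- `u` are nearly constant, and the complement with loops is a disjoint union of cliques, so no walk
-- in it joins adjacent vertices. What the bound discards, X and the variance, therefore measures
-- the distance from that graph. The vector 8u - 3nd comes from completing a square: 16(4|u|² -
-- 3n⟨d,u⟩) = |8u - 3nd|² - 9n²|d|². Everything happens over the integers, with E for 1/ε and q for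
-- an integer at least 1/δ, so that each estimate becomes a polynomial inequality with a sign
-- certificate. Cauchy-Schwarz bounds squares of the cherry count and of the degree deviations;
-- hence E is of order M², where 1/M is the relative accuracy that the clustering must start from.
-- Each of the k rounds divides the accuracy by a constant depending on k, so the final ε is
-- quadratic in δ with a factor exponential in k log k.

module Integral where

  open import Defs hiding (sym)
  open import Data.Bool.Base using (Bool; true; false; if_then_else_; not; _∧_; _∨_)
  import Data.Bool.Properties as Bool
  open import Data.Nat.Base as ℕ using (ℕ; zero; suc; NonZero)
  import Data.Nat.Properties as ℕ
  open import Data.Nat.DivMod using (_/_; _%_; m≡m%n+[m/n]*n; m%n<n; /-monoˡ-≤; m/n*n≤m)
  open import Data.Fin.Base as Fin using (Fin; zero; suc; toℕ; fromℕ<)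
  open import Data.Fin.Properties as Fin using (any?; toℕ-fromℕ<; toℕ-injective; toℕ<n)
  open import Data.Fin.Permutation as Perm using (Permutation; _⟨$⟩ʳ_; transpose; _∘ₚ_)
  open import Data.Integer.Base hiding (_/_; _%_; NonZero) renaming (suc to sucℤ)
  open import Data.Integer.Properties
  open import Data.Integer.Tactic.RingSolver using (solve-∀)
  open import Data.List.Base using (List; _∷_; length; filter; concatMap; map; tabulate; _++_)
  open import Data.List.Properties using (filter-++; length-++)
  open import Data.Product using (_×_; _,_; proj₁; proj₂; ∃; Σ)
  open import Data.Sum using (_⊎_; inj₁; inj₂)
  open import Function using (_∘_; id)
  open import Relation.Binary.PropositionalEquality
  open import Relation.Nullary using (Dec; yes; no; does; ¬_; ¬?; contradiction; _×-dec_)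
  open import Relation.Nullary.Decidable using (dec-true; dec-false; decidable-stable)
  open import Relation.Unary using (Decidable)
  import Algebra.Properties.Semiring.Sum +-*-semiring as Sum

  -- Nonnegativity certificates

  infixl 6 _⊹_
  infixl 7 _⊛_

  _⊹_ : ∀ {a b} → 0ℤ ≤ a → 0ℤ ≤ b → 0ℤ ≤ a + b
  _⊹_ = +-mono-≤

  _⊛_ : ∀ {a b} → 0ℤ ≤ a → 0ℤ ≤ b → 0ℤ ≤ a * b
  _⊛_ {+ m} {+ n} _ _ = subst (0ℤ ≤_) (pos-* m n) (+≤+ ℕ.z≤n)

  0≤sq : ∀ a → 0ℤ ≤ a * a
  0≤sq (+ n)    = subst (0ℤ ≤_) (pos-* n n) (+≤+ ℕ.z≤n)
  0≤sq -[1+ n ] = +≤+ ℕ.z≤n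

  0≤+ : ∀ {n} → 0ℤ ≤ + n
  0≤+ = +≤+ ℕ.z≤n

  -- The pattern of most inequalities below: the ring solver rewrites the gap as a sum of products
  -- of nonnegative terms, and `_⊹_` and `_⊛_` assemble the sign of that sum from the hypotheses.
  certify : ∀ {a b t} → b - a ≡ t → 0ℤ ≤ t → a ≤ b
  certify eq 0≤t = 0≤i-j⇒j≤i (subst (0ℤ ≤_) (sym eq) 0≤t)

  gap : ∀ {a b} → a ≤ b → 0ℤ ≤ b - a
  gap = i≤j⇒0≤j-i

  *-monoˡ : ∀ {a b c} → 0ℤ ≤ c → a ≤ b → c * a ≤ c * b
  *-monoˡ {a} {b} {c} p q = certify (eq a b c) (p ⊛ gap q)
    where
    eq : ∀ a b c → c * b - c * a ≡ c * (b - a)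
    eq = solve-∀

  *-mono : ∀ {a b c d} → 0ℤ ≤ a → 0ℤ ≤ d → a ≤ b → c ≤ d → a * c ≤ b * d
  *-mono {a} {b} {c} {d} 0≤a 0≤d p q = certify (eq a b c d) (gap p ⊛ 0≤d ⊹ 0≤a ⊛ gap q)
    where
    eq : ∀ a b c d → b * d - a * c ≡ (b - a) * d + a * (d - c)
    eq = solve-∀

  *-cancelˡ : ∀ {a b c} → 1ℤ ≤ c → c * a ≤ c * b → a ≤ b
  *-cancelˡ {a} {b} {+ suc m} _ p = *-cancelˡ-≤-pos a b (+ suc m) p
  *-cancelˡ {c = + 0} (+≤+ ()) _
  *-cancelˡ {c = -[1+ _ ]} () _

  1≤-* : ∀ {a b} → 1ℤ ≤ a → 1ℤ ≤ b → 1ℤ ≤ a * b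
  1≤-* p q = *-mono 0≤+ (≤-trans 0≤+ q) p q

  sq-cancel : ∀ {a b} → 0ℤ ≤ b → a * a ≤ b * b → a ≤ b
  sq-cancel {a} {b} 0≤b p with a ≤? b
  ... | yes a≤b = a≤b
  ... | no a≰b = contradiction p (<⇒≱ b²<a²)
    where
    b+1≤a : b + 1ℤ ≤ a
    b+1≤a = subst (_≤ a) (+-comm 1ℤ b) (i<j⇒suc[i]≤j (≰⇒> a≰b))
    eq : ∀ a b → a * a - (1ℤ + b * b) ≡ (a - (b + 1ℤ)) * (a + b + 1ℤ) + (b + b)
    eq = solve-∀
    b²<a² : b * b < a * a
    b²<a² = suc[i]≤j⇒i<j (certify (eq a b)
      (gap b+1≤a ⊛ (≤-trans 0≤b (<⇒≤ (≰⇒> a≰b)) ⊹ 0≤b ⊹ 0≤+ {1}) ⊹ (0≤b ⊹ 0≤b)))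

  i≤∣i∣ : ∀ i → i ≤ + ∣ i ∣
  i≤∣i∣ (+ n) = ≤-refl
  i≤∣i∣ -[1+ n ] = -≤+

  -i≤∣i∣ : ∀ i → - i ≤ + ∣ i ∣
  -i≤∣i∣ i = subst (λ m → - i ≤ + m) (∣-i∣≡∣i∣ i) (i≤∣i∣ (- i))

  ∣i∣²≡i² : ∀ i → + ∣ i ∣ * + ∣ i ∣ ≡ i * i
  ∣i∣²≡i² (+ n) = refl
  ∣i∣²≡i² -[1+ n ] = refl

  -- Finite sums

  -- The sum is abstract so that unification can read off its summand.
  abstract
    ∑ : ∀ {n} → (Fin n → ℤ) → ℤ
    ∑ = Sum.sum

    ∑-cong : ∀ {n} {f g : Fin n → ℤ} → (∀ i → f i ≡ g i) → ∑ f ≡ ∑ g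
    ∑-cong = Sum.sum-cong-≗

    ∑-distrib-+ : ∀ {n} (f g : Fin n → ℤ) → ∑ (λ i → f i + g i) ≡ ∑ f + ∑ g
    ∑-distrib-+ = Sum.∑-distrib-+

    ∑-comm : ∀ {m n} (f : Fin m → Fin n → ℤ) → ∑ (λ i → ∑ (λ j → f i j)) ≡ ∑ (λ j → ∑ (λ i → f i j))
    ∑-comm = Sum.∑-comm

    *-distribˡ-∑ : ∀ {n} c (f : Fin n → ℤ) → c * ∑ f ≡ ∑ (λ i → c * f i)
    *-distribˡ-∑ = Sum.*-distribˡ-sum

    *-distribʳ-∑ : ∀ {n} c (f : Fin n → ℤ) → ∑ f * c ≡ ∑ (λ i → f i * c)
    *-distribʳ-∑ = Sum.*-distribʳ-sum

    ∑-permute : ∀ {m n} (f : Fin n → ℤ) (π : Permutation m n) → ∑ f ≡ ∑ (λ i → f (π ⟨$⟩ʳ i))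
    ∑-permute = Sum.∑-permute

    ∑-zero : (f : Fin 0 → ℤ) → ∑ f ≡ 0ℤ
    ∑-zero f = refl

    ∑-suc : ∀ {n} (f : Fin (suc n) → ℤ) → ∑ f ≡ f zero + ∑ (λ i → f (suc i))
    ∑-suc f = refl

    ∑-mono : ∀ {n} {f g : Fin n → ℤ} → (∀ i → f i ≤ g i) → ∑ f ≤ ∑ g
    ∑-mono {zero} h = ≤-refl
    ∑-mono {suc n} h = +-mono-≤ (h zero) (∑-mono (h ∘ suc))

    ∑-const : ∀ n c → ∑ (λ (i : Fin n) → c) ≡ + n * c
    ∑-const zero c = refl
    ∑-const (suc n) c = trans (cong (λ z → c + z) (∑-const n c)) (sym ([1+m]*n≡n+m*n (+ n) c))
      where
      [1+m]*n≡n+m*n : ∀ m n → (1ℤ + m) * n ≡ n + m * n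
      [1+m]*n≡n+m*n = solve-∀

  infixl 10 ∑
  syntax ∑ (λ i → x) = ∑[ i ] x

  ∑-nonneg : ∀ {n} {f : Fin n → ℤ} → (∀ i → 0ℤ ≤ f i) → 0ℤ ≤ ∑ f
  ∑-nonneg {n} h = ≤-trans (≤-reflexive (sym (trans (∑-const n 0ℤ) (*-zeroʳ (+ n))))) (∑-mono h)

  ∑-bound : ∀ {n} {f : Fin n → ℤ} {c} → (∀ i → f i ≤ c) → ∑ f ≤ + n * c
  ∑-bound {n} {c = c} h = ≤-trans (∑-mono h) (≤-reflexive (∑-const n c))

  infixl 6 _⊞_
  infixr 7 _⊡_

  -- With `_⊡_`, evaluates a sum by a term shaped like its summand. For this the ring identities
  -- first bring summands into linear form, with the coefficients that are constant in the index on
  -- the left, `-1ℤ` included.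
  _⊞_ : ∀ {n} {f g : Fin n → ℤ} {F G} → ∑ f ≡ F → ∑ g ≡ G → ∑[ i ] (f i + g i) ≡ F + G
  _⊞_ {f = f} {g} p q = trans (∑-distrib-+ f g) (cong₂ _+_ p q)

  _⊡_ : ∀ {n} c {f : Fin n → ℤ} {F} → ∑ f ≡ F → ∑[ i ] (c * f i) ≡ c * F
  _⊡_ c {f} p = trans (sym (*-distribˡ-∑ c f)) (cong (c *_) p)

  ∑-*ʳ : ∀ {n} (f : Fin n → ℤ) c → ∑[ i ] (f i * c) ≡ ∑ f * c
  ∑-*ʳ f c = sym (*-distribʳ-∑ c f)

  -- The double sum of the squares of `f i - f j` is twice the gap.
  cauchy-schwarz : ∀ {n} (f : Fin n → ℤ) → ∑ f * ∑ f ≤ + n * ∑[ i ] (f i * f i)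
  cauchy-schwarz {n} f = half (0≤i-j⇒j≤i (subst (0ℤ ≤_) expand (∑-nonneg λ i → ∑-nonneg λ j → 0≤sq (f i - f j))))
    where
    F = ∑ f
    F₂ = ∑[ i ] (f i * f i)
    eq : ∀ a b → (a - b) * (a - b) ≡ a * a + (- + 2 * a) * b + b * b
    eq = solve-∀
    eq′ : ∀ N a F F₂ → N * (a * a) + (- + 2 * a) * F + F₂ ≡ N * (a * a) + (- + 2 * F) * a + F₂
    eq′ = solve-∀
    eq″ : ∀ N F F₂ → N * F₂ + (- + 2 * F) * F + N * F₂ ≡ + 2 * (N * F₂) - + 2 * (F * F)
    eq″ = solve-∀
    expand : ∑[ i ] ∑[ j ] ((f i - f j) * (f i - f j)) ≡ + 2 * (+ n * F₂) - + 2 * (F * F)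
    expand = trans (∑-cong λ i → trans (∑-cong λ j → eq (f i) (f j))
                     (trans (∑-const n (f i * f i) ⊞ (- + 2 * f i) ⊡ refl ⊞ refl) (eq′ (+ n) (f i) F F₂)))
            (trans ((+ n ⊡ refl) ⊞ (- + 2 * F) ⊡ refl ⊞ ∑-const n F₂) (eq″ (+ n) F F₂))
    half : + 2 * (F * F) ≤ + 2 * (+ n * F₂) → F * F ≤ + n * F₂
    half = *-cancelˡ {c = + 2} (+≤+ (ℕ.s≤s ℕ.z≤n))

  Bit : ℤ → Set
  Bit r = r ≡ 0ℤ ⊎ r ≡ 1ℤ

  Bit-0≤ : ∀ {r} → Bit r → 0ℤ ≤ r
  Bit-0≤ (inj₁ refl) = 0≤+
  Bit-0≤ (inj₂ refl) = 0≤+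

  Bit-≤1 : ∀ {r} → Bit r → r ≤ 1ℤ
  Bit-≤1 (inj₁ refl) = +≤+ ℕ.z≤n
  Bit-≤1 (inj₂ refl) = ≤-refl

  Bit-idem : ∀ {r} → Bit r → r * r ≡ r
  Bit-idem (inj₁ refl) = refl
  Bit-idem (inj₂ refl) = refl

  Bit-not : ∀ {r} → Bit r → Bit (1ℤ - r)
  Bit-not (inj₁ refl) = inj₂ refl
  Bit-not (inj₂ refl) = inj₁ refl

  Bit-* : ∀ {r s} → Bit r → Bit s → Bit (r * s)
  Bit-* (inj₁ refl) _ = inj₁ refl
  Bit-* (inj₂ refl) (inj₁ refl) = inj₁ refl
  Bit-* (inj₂ refl) (inj₂ refl) = inj₂ refl

  -- Averaging without division: if every selected index failed, integrality would lift `∑ r * f i`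
  -- to at least T + 1 there, and summation would give T + 1 ≤ T.
  ∃-≤-average : ∀ {n} (r f : Fin n → ℤ) {T} → (∀ i → Bit (r i)) → 1ℤ ≤ ∑ r →
                ∑[ i ] (r i * f i) ≤ T → ∃ λ i → r i ≡ 1ℤ × ∑ r * f i ≤ T
  ∃-≤-average {n} r f {T} bit 1≤ρ avg with any? (λ i → Relation.Nullary._×-dec_ (r i ≟ 1ℤ) (∑ r * f i ≤? T))
  ... | yes found = found
  ... | no none = contradiction above (<⇒≱ (suc[i]≤j⇒i<j ≤-refl))
    where
    ρ = ∑ r
    eq : ∀ r ρ f → ρ * (r * f) ≡ r * (ρ * f)
    eq = solve-∀
    pointwise : ∀ i → sucℤ T * r i ≤ ρ * (r i * f i)
    pointwise i with bit i
    ... | inj₁ r≡0 rewrite r≡0 = ≤-reflexive (trans (*-zeroʳ (sucℤ T)) (sym (*-zeroʳ ρ)))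
    ... | inj₂ r≡1 with ρ * f i ≤? T
    ...   | yes p = contradiction (i , r≡1 , p) none
    ...   | no ¬p = subst₂ _≤_ (sym (trans (cong (sucℤ T *_) r≡1) (*-identityʳ _)))
                      (sym (trans (cong (λ r → ρ * (r * f i)) r≡1) (cong (ρ *_) (*-identityˡ (f i)))))
                      (i<j⇒suc[i]≤j (≰⇒> ¬p))
    above : sucℤ T ≤ T
    above = *-cancelˡ 1≤ρ (begin
      ρ * sucℤ T                     ≡⟨ *-comm ρ (sucℤ T) ⟩
      sucℤ T * ρ                     ≡⟨ sucℤ T ⊡ refl ⟨
      ∑[ i ] (sucℤ T * r i)      ≤⟨ ∑-mono pointwise ⟩
      ∑[ i ] (ρ * (r i * f i))   ≡⟨ ρ ⊡ refl ⟩
      ρ * ∑[ i ] (r i * f i)     ≤⟨ *-monoˡ (≤-trans 0≤+ 1≤ρ) avg ⟩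
      ρ * T                          ∎)
      where open ≤-Reasoning

  -- The pentagon identity

  module Kernel {n : ℕ} (A : Fin n → Fin n → ℤ) (A-sym : ∀ x y → A x y ≡ A y x)
                (A-bit : ∀ x y → Bit (A x y)) where

    N = + n

    𝔸 : (Fin n → ℤ) → Fin n → ℤ
    𝔸 f x = ∑[ y ] (A x y * f y)

    ⟨_,_⟩ : (Fin n → ℤ) → (Fin n → ℤ) → ℤ
    ⟨ f , g ⟩ = ∑[ x ] (f x * g x)

    d u v w : Fin n → ℤ
    d x = ∑[ y ] A x y
    u = 𝔸 d
    v = 𝔸 u
    w = 𝔸 v

    D S P₄ P₅ V : ℤ
    D = ∑ d
    S = ⟨ d , d ⟩
    P₄ = ⟨ d , u ⟩
    P₅ = ⟨ u , u ⟩
    V = N * S - D * D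

    Q : Fin n → Fin n → ℤ
    Q x y = ∑[ z ] (A x z * A z y)

    B P : Fin n → Fin n → ℤ
    B x y = 1ℤ - A x y
    P x y = ∑[ z ] (B x z * B z y)

    -- X counts the 4-walks of the complement whose endpoints are adjacent in the graph.
    C₅ X : ℤ
    C₅ = ∑[ a ] ∑[ c ] (Q a c * ∑[ e ] (A a e * Q c e))
    X  = ∑[ a ] ∑[ c ] (P a c * ∑[ e ] (A a e * P c e))

    𝔸-adjoint : ∀ f g → ⟨ f , 𝔸 g ⟩ ≡ ⟨ 𝔸 f , g ⟩
    𝔸-adjoint f g = begin
      ∑[ x ] (f x * 𝔸 g x)                      ≡⟨ ∑-cong (λ x → sym (f x ⊡ refl)) ⟩
      ∑[ x ] ∑[ y ] (f x * (A x y * g y))   ≡⟨ ∑-comm _ ⟩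
      ∑[ y ] ∑[ x ] (f x * (A x y * g y))   ≡⟨ ∑-cong (λ y → trans (∑-cong λ x →
                                                        trans (cong (λ r → f x * (r * g y)) (A-sym x y)) (eq (f x) (A y x) (g y)))
                                                        (∑-*ʳ (λ x → A y x * f x) (g y))) ⟩
      ∑[ y ] (𝔸 f y * g y)                      ∎
      where
      open ≡-Reasoning
      eq : ∀ a b c → a * (b * c) ≡ (b * a) * c
      eq = solve-∀

    ∑𝔸 : ∀ f → ∑ (𝔸 f) ≡ ⟨ d , f ⟩
    ∑𝔸 f = trans (∑-comm _) (∑-cong λ y →
      trans (∑-*ʳ (λ x → A x y) (f y)) (cong (_* f y) (∑-cong λ x → A-sym x y)))

    Q-sym : ∀ x y → Q x y ≡ Q y x
    Q-sym x y = ∑-cong λ z → trans (cong₂ _*_ (A-sym x z) (A-sym z y)) (*-comm (A z x) (A y z))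

    Q-apply : ∀ f a → ∑[ c ] (Q a c * f c) ≡ 𝔸 (𝔸 f) a
    Q-apply f a = begin
      ∑[ c ] (Q a c * f c)                       ≡⟨ ∑-cong (λ c → sym (∑-*ʳ _ (f c))) ⟩
      ∑[ c ] ∑[ b ] (A a b * A b c * f c)    ≡⟨ ∑-comm _ ⟩
      ∑[ b ] ∑[ c ] (A a b * A b c * f c)    ≡⟨ ∑-cong (λ b → trans (∑-cong λ c → *-assoc (A a b) (A b c) (f c))
                                                                                  (A a b ⊡ refl)) ⟩
      𝔸 (𝔸 f) a                                      ∎
      where open ≡-Reasoning

    -- By symmetry the entries of A³, as `Q` holds those of A²; `C₅`, the trace of A⁵, is the sum of
    -- the products `Q a c * R a c`.
    R : Fin n → Fin n → ℤ
    R a c = ∑[ e ] (A a e * Q c e)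

    R-apply : ∀ f a → ∑[ c ] (f c * R a c) ≡ 𝔸 (𝔸 (𝔸 f)) a
    R-apply f a = begin
      ∑[ c ] (f c * R a c)                         ≡⟨ ∑-cong (λ c → sym (f c ⊡ refl)) ⟩
      ∑[ c ] ∑[ e ] (f c * (A a e * Q c e))    ≡⟨ ∑-comm _ ⟩
      ∑[ e ] ∑[ c ] (f c * (A a e * Q c e))    ≡⟨ ∑-cong (λ e → trans (∑-cong λ c →
                                                            trans (cong (λ r → f c * (A a e * r)) (Q-sym c e)) (eq (f c) (A a e) (Q e c)))
                                                            (A a e ⊡ Q-apply f e)) ⟩
      𝔸 (𝔸 (𝔸 f)) a                                    ∎
      where
      open ≡-Reasoning
      eq : ∀ a b c → a * (b * c) ≡ b * (c * a)
      eq = solve-∀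

    𝟏 : Fin n → ℤ
    𝟏 _ = 1ℤ

    𝔸-cong : ∀ {f g} → (∀ x → f x ≡ g x) → ∀ x → 𝔸 f x ≡ 𝔸 g x
    𝔸-cong f≗g x = ∑-cong λ y → cong (A x y *_) (f≗g y)

    𝔸𝟏 : ∀ x → 𝔸 𝟏 x ≡ d x
    𝔸𝟏 x = ∑-cong λ y → *-identityʳ (A x y)

    ∑Q : ∀ a → ∑[ c ] Q a c ≡ u a
    ∑Q a = trans (∑-cong λ c → sym (*-identityʳ (Q a c))) (trans (Q-apply 𝟏 a) (𝔸-cong 𝔸𝟏 a))

    ∑R : ∀ a → ∑[ c ] R a c ≡ v a
    ∑R a = trans (∑-cong λ c → sym (*-identityˡ (R a c)))
            (trans (R-apply 𝟏 a) (𝔸-cong (𝔸-cong 𝔸𝟏) a))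

    P-expand : ∀ x y → P x y ≡ N - d x - d y + Q x y
    P-expand x y = trans (∑-cong λ z → eq (A x z) (A z y))
      (trans (∑-const n 1ℤ ⊞ (-1ℤ ⊡ refl) ⊞ (-1ℤ ⊡ (∑-cong λ z → A-sym z y)) ⊞ refl) (eq′ N (d x) (d y) (Q x y)))
      where
      eq : ∀ a b → (1ℤ - a) * (1ℤ - b) ≡ 1ℤ + -1ℤ * a + -1ℤ * b + a * b
      eq = solve-∀
      eq′ : ∀ N a b q → N * 1ℤ + -1ℤ * a + -1ℤ * b + q ≡ N - a - b + q
      eq′ = solve-∀

    private
      inner-e : ∀ a c → ∑[ e ] (A a e * P c e) ≡ (N * d a - u a) - d a * d c + R a c
      inner-e a c = trans (∑-cong λ e → trans (cong (A a e *_) (P-expand c e)) (eq (A a e) N (d c) (d e) (Q c e)))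
        (trans (((N - d c) ⊡ refl) ⊞ (-1ℤ ⊡ refl) ⊞ refl) (eq′ N (d a) (d c) (u a) (R a c)))
        where
        eq : ∀ A N c e q → A * (N - c - e + q) ≡ (N - c) * A + -1ℤ * (A * e) + A * q
        eq = solve-∀
        eq′ : ∀ N a c u r → (N - c) * a + -1ℤ * u + r ≡ (N * a - u) - a * c + r
        eq′ = solve-∀

      inner-c : ∀ a → ∑[ c ] (P a c * ∑[ e ] (A a e * P c e)) ≡
        N * ((N - d a) * (N * d a - u a)) + - ((N - d a) * d a + (N * d a - u a)) * D + (N - d a) * v a
        + d a * S + -1ℤ * w a + (N * d a - u a) * u a + (- d a) * v a + ∑[ c ] (Q a c * R a c)
      inner-c a = trans (∑-cong λ c → trans (cong₂ _*_ (P-expand a c) (inner-e a c))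
                            (eq (N - d a) (N * d a - u a) (d a) (d c) (Q a c) (R a c)))
        (∑-const n ((N - d a) * (N * d a - u a)) ⊞ ((- ((N - d a) * d a + (N * d a - u a))) ⊡ refl) ⊞ ((N - d a) ⊡ ∑R a)
         ⊞ (d a ⊡ refl) ⊞ (-1ℤ ⊡ R-apply d a) ⊞ ((N * d a - u a) ⊡ ∑Q a) ⊞ ((- d a) ⊡ Q-apply d a) ⊞ refl)
        where
        -- Only `c`, `q` and `r` vary with the inner vertex; α = N - d a, β = N d a - u a and γ = d
        -- a do not. Seven of the eight terms sum to walk counts at `a`, the last to its share of
        -- `C₅`.
        eq : ∀ α β γ c q r → (α - c + q) * (β - γ * c + r) ≡
          α * β + - (α * γ + β) * c + α * r + γ * (c * c) + -1ℤ * (c * r) + β * q + (- γ) * (q * c) + q * r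
        eq = solve-∀

    ∑u≡S : ∑ u ≡ S
    ∑u≡S = ∑𝔸 d

    -- Taking -A in all four factors 1 - A of a walk gives `C₅` with sign +. Any other choice breaks
    -- the 5-cycle into paths, and `𝔸-adjoint` reduces their numbers to D, S, P₄ and P₅.
    C₅-identity : C₅ ≡ X + (+ 4 * P₅ - + 3 * (N * P₄) + (+ 2 * (N * N) - + 3 * D) * S + + 2 * (N * (D * D)) - N * (N * (N * D)))
    C₅-identity = sym (trans (cong (_+ (+ 4 * P₅ - + 3 * (N * P₄) + (+ 2 * (N * N) - + 3 * D) * S + + 2 * (N * (D * D)) - N * (N * (N * D)))) X-expand) (eq N D S P₄ P₅ C₅))
      where
      regroup : ∀ N D S d u v w c →
        N * ((N - d) * (N * d - u)) + - ((N - d) * d + (N * d - u)) * D + (N - d) * v + d * S + -1ℤ * w + (N * d - u) * u + (- d) * v + c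
        ≡ (N * (N * N) - + 2 * (N * D) + S) * d + (D - N * N) * u + N * v + -1ℤ * w
          + (D - N * N) * (d * d) + (+ 2 * N) * (d * u) + - (+ 2) * (d * v) + -1ℤ * (u * u) + c
      regroup = solve-∀
      X-expand : X ≡ (N * (N * N) - + 2 * (N * D) + S) * D + (D - N * N) * S + N * P₄ + -1ℤ * P₅
          + (D - N * N) * S + (+ 2 * N) * P₄ + - (+ 2) * P₅ + -1ℤ * P₅ + C₅
      X-expand = trans (∑-cong λ a → trans (inner-c a) (regroup N D S (d a) (u a) (v a) (w a) _))
        (((N * (N * N) - + 2 * (N * D) + S) ⊡ refl) ⊞ ((D - N * N) ⊡ ∑u≡S) ⊞ (N ⊡ ∑𝔸 u) ⊞ (-1ℤ ⊡ trans (∑𝔸 v) (𝔸-adjoint d u))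
         ⊞ ((D - N * N) ⊡ refl) ⊞ ((+ 2 * N) ⊡ refl) ⊞ ((- (+ 2)) ⊡ 𝔸-adjoint d u) ⊞ (-1ℤ ⊡ refl) ⊞ refl)
      eq : ∀ N D S P₄ P₅ C₅ →
        (N * (N * N) - + 2 * (N * D) + S) * D + (D - N * N) * S + N * P₄ + -1ℤ * P₅
          + (D - N * N) * S + (+ 2 * N) * P₄ + - (+ 2) * P₅ + -1ℤ * P₅ + C₅
        + (+ 4 * P₅ - + 3 * (N * P₄) + (+ 2 * (N * N) - + 3 * D) * S + + 2 * (N * (D * D)) - N * (N * (N * D))) ≡ C₅
      eq = solve-∀

  -- Lower bound at density 1 − 1/k

  expand-square : ∀ N u d → (+ 8 * u - + 3 * (N * d)) * (+ 8 * u - + 3 * (N * d))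
                  ≡ + 64 * (u * u) + - (+ 48) * N * (d * u) + + 9 * (N * N) * (d * d)
  expand-square = solve-∀

  -- After completing the square, S is eliminated through V = N S - D². The coefficient of V is then
  -- 128D² - 96N²D + 23N⁴ + 64V; the quadratic in D has minimum 5N⁴, at D = 3N²/8, and this is the
  -- multiple of the variance that is kept.
  certificate : ∀ N D S P₄ P₅ X →
    + 16 * (N * N * N * (X + (+ 4 * P₅ - + 3 * (N * P₄) + (+ 2 * (N * N) - + 3 * D) * S + + 2 * (N * (D * D)) - N * (N * (N * D)))))
      - (+ 16 * (N * N * N * X)
         + + 16 * (+ 4 * (D * D * (D * D)) - + 6 * (N * N * (D * D * D)) + + 4 * (N * N * (N * N) * (D * D)) - N * N * (N * N) * (N * N) * D)
         + + 5 * (N * N * (N * N) * (N * S - D * D)))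
    ≡ N * N * (N * (+ 64 * P₅ + - (+ 48) * N * P₄ + + 9 * (N * N) * S) - (+ 8 * S - + 3 * (N * D)) * (+ 8 * S - + 3 * (N * D)))
      + (N * S - D * D) * (+ 2 * ((+ 8 * D - + 3 * (N * N)) * (+ 8 * D - + 3 * (N * N))) + + 64 * (N * S - D * D))
  certificate = solve-∀

  lower-bound : ∀ N D S P₄ P₅ X C₅ →
    C₅ ≡ X + (+ 4 * P₅ - + 3 * (N * P₄) + (+ 2 * (N * N) - + 3 * D) * S + + 2 * (N * (D * D)) - N * (N * (N * D))) →
    0ℤ ≤ N * (+ 64 * P₅ + - (+ 48) * N * P₄ + + 9 * (N * N) * S) - (+ 8 * S - + 3 * (N * D)) * (+ 8 * S - + 3 * (N * D)) →
    0ℤ ≤ N * S - D * D →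
    + 16 * (N * N * N * X)
         + + 16 * (+ 4 * (D * D * (D * D)) - + 6 * (N * N * (D * D * D)) + + 4 * (N * N * (N * N) * (D * D)) - N * N * (N * N) * (N * N) * D)
         + + 5 * (N * N * (N * N) * (N * S - D * D))
         ≤ + 16 * (N * N * N * C₅)
  lower-bound N D S P₄ P₅ X _ refl 0≤var 0≤V = certify (certificate N D S P₄ P₅ X)
    (0≤sq N ⊛ 0≤var ⊹ 0≤V ⊛ (0≤+ {2} ⊛ 0≤sq (+ 8 * D - + 3 * (N * N)) ⊹ 0≤+ {64} ⊛ 0≤V))

  module Pentagon {n : ℕ} (A : Fin n → Fin n → ℤ) (A-sym : ∀ x y → A x y ≡ A y x)
                (A-bit : ∀ x y → Bit (A x y)) where
    open Kernel A A-sym A-bit public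

    0≤V : 0ℤ ≤ V
    0≤V = gap (cauchy-schwarz d)

    private
      0≤variance : 0ℤ ≤ N * (+ 64 * P₅ + - (+ 48) * N * P₄ + + 9 * (N * N) * S) - (+ 8 * S - + 3 * (N * D)) * (+ 8 * S - + 3 * (N * D))
      0≤variance = gap (subst₂ _≤_ (cong₂ _*_ ∑f ∑f) (cong (N *_) ∑f²) (cauchy-schwarz f))
        where
        f : Fin n → ℤ
        f x = + 8 * u x - + 3 * (N * d x)
        eq : ∀ N u d → + 8 * u - + 3 * (N * d) ≡ + 8 * u + (- (+ 3) * N) * d
        eq = solve-∀
        ∑f : ∑ f ≡ + 8 * S - + 3 * (N * D)
        ∑f = trans (∑-cong λ x → eq N (u x) (d x)) (trans ((+ 8 ⊡ ∑u≡S) ⊞ ((- (+ 3) * N) ⊡ refl)) (sym (eq N S D)))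
        ∑f² : ∑[ x ] (f x * f x) ≡ + 64 * P₅ + - (+ 48) * N * P₄ + + 9 * (N * N) * S
        ∑f² = trans (∑-cong λ x → expand-square N (u x) (d x))
                ((+ 64 ⊡ refl) ⊞ ((- (+ 48) * N) ⊡ refl) ⊞ ((+ 9 * (N * N)) ⊡ refl))

    C₅-lower : + 16 * (N * N * N * X)
           + + 16 * (+ 4 * (D * D * (D * D)) - + 6 * (N * N * (D * D * D)) + + 4 * (N * N * (N * N) * (D * D)) - N * N * (N * N) * (N * N) * D)
           + + 5 * (N * N * (N * N) * V)
           ≤ + 16 * (N * N * N * C₅)
    C₅-lower = lower-bound N D S P₄ P₅ X C₅ C₅-identity 0≤variance 0≤V

  -- h₀ k / k⁴ is the density of homomorphisms C₅ → K_k, and h₁ k / k³ the slope of the tangent at edge density 1 − 1/k.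
  h₀ h₁ : ℤ → ℤ
  h₀ k = k * k * (k * k) - + 5 * (k * k * k) + + 10 * (k * k) - + 10 * k + + 4
  h₁ k = + 5 * (k * k * k) - + 20 * (k * k) + + 30 * k - + 16

  quartic : ℤ → ℤ → ℤ
  quartic M D = + 4 * (D * D * (D * D)) - + 6 * (M * (D * D * D)) + + 4 * (M * M * (D * D)) - M * M * M * D

  -- The gap has a double root at y = 0, the density 1 - 1/k. The remaining quadratic in y is
  -- completed to a square plus a nonnegative multiple of M², so the tangent lies below the quartic
  -- at every density.
  tangent : ∀ k M D → let y = k * D - (k - 1ℤ) * M in
    h₀ k * (M * M * (M * M)) + h₁ k * (M * M * M) * y ≤ k * k * (k * k) * quartic M D
  tangent k M D = *-cancelˡ {c = + 16} (+≤+ (ℕ.s≤s ℕ.z≤n)) (certify (eq k M D)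
    (0≤sq y ⊛ (0≤+ {4} ⊛ 0≤sq (+ 4 * y + (+ 5 * k - + 8) * M) ⊹ (0≤+ {2} ⊛ 0≤sq (+ 5 * k - + 8) ⊹ 0≤+ {10} ⊛ 0≤sq k) ⊛ 0≤sq M)))
    where
    y = k * D - (k - 1ℤ) * M
    eq : ∀ k M D → let y = k * D - (k - 1ℤ) * M in
      + 16 * (k * k * (k * k) * (+ 4 * (D * D * (D * D)) - + 6 * (M * (D * D * D)) + + 4 * (M * M * (D * D)) - M * M * M * D))
       - + 16 * ((k * k * (k * k) - + 5 * (k * k * k) + + 10 * (k * k) - + 10 * k + + 4) * (M * M * (M * M)) + (+ 5 * (k * k * k) - + 20 * (k * k) + + 30 * k - + 16) * (M * M * M) * y)
      ≡ y * y * (+ 4 * ((+ 4 * y + (+ 5 * k - + 8) * M) * (+ 4 * y + (+ 5 * k - + 8) * M)) + (+ 2 * ((+ 5 * k - + 8) * (+ 5 * k - + 8)) + + 10 * (k * k)) * (M * M))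
    eq = solve-∀

  -- In powers of k - 3 the difference has nonnegative coefficients.
  1≤h₁ : ∀ {k} → + 3 ≤ k → 1ℤ ≤ h₁ k
  1≤h₁ {k} 3≤k = certify (eq k) (0≤+ {5} ⊛ (q ⊛ q ⊛ q) ⊹ 0≤+ {25} ⊛ (q ⊛ q) ⊹ 0≤+ {45} ⊛ q ⊹ 0≤+ {28})
    where
    q = gap 3≤k
    eq : ∀ k → (+ 5 * (k * k * k) - + 20 * (k * k) + + 30 * k - + 16) - 1ℤ
      ≡ + 5 * ((k - + 3) * (k - + 3) * (k - + 3)) + + 25 * ((k - + 3) * (k - + 3)) + + 45 * (k - + 3) + + 28
    eq = solve-∀

  h₁≤5k³ : ∀ {k} → + 3 ≤ k → h₁ k ≤ + 5 * (k * k * k)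
  h₁≤5k³ {k} 3≤k = certify (eq k) (0≤+ {20} ⊛ (q ⊛ q) ⊹ 0≤+ {90} ⊛ q ⊹ 0≤+ {106})
    where
    q = gap 3≤k
    eq : ∀ k → + 5 * (k * k * k) - (+ 5 * (k * k * k) - + 20 * (k * k) + + 30 * k - + 16)
      ≡ + 20 * ((k - + 3) * (k - + 3)) + + 90 * (k - + 3) + + 106
    eq = solve-∀

  divide-N³ : ∀ {N X C V H y} K a b → 1ℤ ≤ N → 0ℤ ≤ K →
    + 16 * (N * N * N * X) + + 16 * H + + 5 * (N * N * (N * N) * V) ≤ + 16 * (N * N * N * C) →
    a * (N * N * (N * N) * (N * N * (N * N))) + b * (N * N * (N * N) * (N * N)) * y ≤ K * H →
    + 16 * (K * X) + + 16 * (a * (N * N * (N * N) * N)) + + 16 * (b * (N * N * N) * y) + + 5 * (K * (N * V)) ≤ + 16 * (K * C)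
  divide-N³ {N} {X} {C} {V} {H} {y} K a b 1≤N 0≤K p q =
    *-cancelˡ (1≤-* (1≤-* 1≤N 1≤N) 1≤N) (certify (eq N X C V H y K a b) (0≤K ⊛ gap p ⊹ 0≤+ {16} ⊛ gap q))
    where
    eq : ∀ N X C V H y K a b →
      N * N * N * (+ 16 * (K * C)) - N * N * N * (+ 16 * (K * X) + + 16 * (a * (N * N * (N * N) * N)) + + 16 * (b * (N * N * N) * y) + + 5 * (K * (N * V)))
      ≡ K * (+ 16 * (N * N * N * C) - (+ 16 * (N * N * N * X) + + 16 * H + + 5 * (N * N * (N * N) * V)))
        + + 16 * (K * H - (a * (N * N * (N * N) * (N * N * (N * N))) + b * (N * N * (N * N) * (N * N)) * y))
    eq = solve-∀

  -- X and the variance must fit between the lower bound and the permitted number of copies. A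
  -- deficit of 2kN²/E in y lowers the tangent by at most the slope times it, and `h₁ k ≤ 5k³` turns
  -- this into the constant 16·2·5 = 160.
  defect-bound : ∀ {N X C V y K a b c E k} → 0ℤ ≤ E → 0ℤ ≤ N → 0ℤ ≤ b → K ≡ k * k * (k * k) → b ≤ + 5 * (k * k * k) → 0ℤ ≤ k →
    + 16 * (K * X) + + 16 * (a * (N * N * (N * N) * N)) + + 16 * (b * (N * N * N) * y) + + 5 * (K * (N * V)) ≤ + 16 * (K * C) →
    K * (E * C) ≤ a * E * (N * N * (N * N) * N) + c * (K * (N * N * (N * N) * N)) →
    - (+ 2 * (k * (N * N))) ≤ E * y →
    K * (+ 16 * (E * X) + + 5 * (E * (N * V))) ≤ K * ((+ 16 * c + + 160) * (N * N * (N * N) * N))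
  defect-bound {N} {X} {C} {V} {y} {_} {a} {b} {c} {E} {k} 0≤E 0≤N 0≤b refl b≤ 0≤k p q r =
    certify (eq N X C V y a b c E k)
     (0≤E ⊛ gap p ⊹ 0≤+ {16} ⊛ gap q ⊹ 0≤+ {16} ⊛ (0≤b ⊛ (0≤sq N ⊛ 0≤N) ⊛ gap r)
      ⊹ 0≤+ {32} ⊛ (0≤k ⊛ (0≤sq N ⊛ (0≤sq N ⊛ 0≤N)) ⊛ gap b≤))
    where
    eq : ∀ N X C V y a b c E k → let K = k * k * (k * k) in
      K * ((+ 16 * c + + 160) * (N * N * (N * N) * N)) - K * (+ 16 * (E * X) + + 5 * (E * (N * V)))
      ≡ E * (+ 16 * (K * C) - (+ 16 * (K * X) + + 16 * (a * (N * N * (N * N) * N)) + + 16 * (b * (N * N * N) * y) + + 5 * (K * (N * V))))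
      + + 16 * (a * E * (N * N * (N * N) * N) + c * (K * (N * N * (N * N) * N)) - K * (E * C))
      + + 16 * (b * (N * N * N) * (E * y - - (+ 2 * (k * (N * N)))))
      + + 32 * (k * (N * N * (N * N * N)) * (+ 5 * (k * k * k) - b))
    eq = solve-∀

  -- The same comparison read for y: with X and V dropped, the slope bounds the edge density from
  -- above, whereas the edge hypothesis bounds it only from below.
  excess-bound : ∀ {N X C V y K a b c E} → 0ℤ ≤ E → 0ℤ ≤ N → 0ℤ ≤ K → 0ℤ ≤ X → 0ℤ ≤ V →
    + 16 * (K * X) + + 16 * (a * (N * N * (N * N) * N)) + + 16 * (b * (N * N * N) * y) + + 5 * (K * (N * V)) ≤ + 16 * (K * C) →
    K * (E * C) ≤ a * E * (N * N * (N * N) * N) + c * (K * (N * N * (N * N) * N)) →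
    + 16 * (N * N * N) * (b * (E * y)) ≤ + 16 * (N * N * N) * (c * (K * (N * N)))
  excess-bound {N} {X} {C} {V} {y} {K} {a} {b} {c} {E} 0≤E 0≤N 0≤K 0≤X 0≤V p q =
    certify (eq N X C V y K a b c E)
     (0≤E ⊛ gap p ⊹ 0≤+ {16} ⊛ gap q ⊹ 0≤+ {16} ⊛ (0≤K ⊛ 0≤E ⊛ 0≤X) ⊹ 0≤+ {5} ⊛ (0≤K ⊛ 0≤E ⊛ 0≤N ⊛ 0≤V))
    where
    eq : ∀ N X C V y K a b c E →
      + 16 * (N * N * N) * (c * (K * (N * N))) - + 16 * (N * N * N) * (b * (E * y))
      ≡ E * (+ 16 * (K * C) - (+ 16 * (K * X) + + 16 * (a * (N * N * (N * N) * N)) + + 16 * (b * (N * N * N) * y) + + 5 * (K * (N * V))))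
      + + 16 * (a * E * (N * N * (N * N) * N) + c * (K * (N * N * (N * N) * N)) - K * (E * C))
      + + 16 * (K * E * X) + + 5 * (K * E * N * V)
    eq = solve-∀

  -- Induced cherries of the complement

  module Cherries {n : ℕ} (A : Fin n → Fin n → ℤ) (A-sym : ∀ x y → A x y ≡ A y x)
                (A-bit : ∀ x y → Bit (A x y)) where
    open Pentagon A A-sym A-bit public

    0≤A : ∀ x y → 0ℤ ≤ A x y
    0≤A x y = Bit-0≤ (A-bit x y)

    B-bit : ∀ x y → Bit (B x y)
    B-bit x y = Bit-not (A-bit x y)

    0≤B : ∀ x y → 0ℤ ≤ B x y
    0≤B x y = Bit-0≤ (B-bit x y)

    B-sym : ∀ x y → B x y ≡ B y x
    B-sym x y = cong (λ r → 1ℤ - r) (A-sym x y)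

    0≤P : ∀ x y → 0ℤ ≤ P x y
    0≤P x y = ∑-nonneg λ z → 0≤B x z ⊛ 0≤B z y

    b : Fin n → ℤ
    b x = ∑[ y ] B x y

    b≡N-d : ∀ x → b x ≡ N - d x
    b≡N-d x = trans (∑-cong λ y → eq (A x y)) (trans (∑-const n 1ℤ ⊞ (-1ℤ ⊡ refl)) (eq′ N (d x)))
      where
      eq : ∀ a → 1ℤ - a ≡ 1ℤ + -1ℤ * a
      eq = solve-∀
      eq′ : ∀ N d → N * 1ℤ + -1ℤ * d ≡ N - d
      eq′ = solve-∀

    -- Y counts the cherries of the complement whose endpoints are adjacent in the graph; Z weights them by the degree of the centre.
    Y Z : ℤ
    Y = ∑[ a ] ∑[ e ] (A a e * P a e)

    τ : Fin n → Fin n → ℤ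
    τ a e = ∑[ x ] (B a x * B x e * b x)

    Z = ∑[ a ] ∑[ e ] (A a e * τ a e)

    X-regroup : X ≡ ∑[ a ] ∑[ e ] (A a e * ∑[ c ] (P a c * P c e))
    X-regroup = ∑-cong λ a → begin
      ∑[ c ] (P a c * ∑[ e ] (A a e * P c e))     ≡⟨ ∑-cong (λ c → *-distribˡ-∑ (P a c) _) ⟩
      ∑[ c ] ∑[ e ] (P a c * (A a e * P c e))     ≡⟨ ∑-comm _ ⟩
      ∑[ e ] ∑[ c ] (P a c * (A a e * P c e))     ≡⟨ ∑-cong (λ e → trans (∑-cong λ c → eq (P a c) (A a e) (P c e)) (A a e ⊡ refl)) ⟩
      ∑[ e ] (A a e * ∑[ c ] (P a c * P c e))     ∎
      where
      open ≡-Reasoning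
      eq : ∀ a b c → a * (b * c) ≡ b * (a * c)
      eq = solve-∀

    0≤X : 0ℤ ≤ X
    0≤X = subst (0ℤ ≤_) (sym X-regroup)
      (∑-nonneg λ a → ∑-nonneg λ e → 0≤A a e ⊛ ∑-nonneg λ c → 0≤P a c ⊛ 0≤P c e)

    -- Restrict the middle walk a – x – c – x′ – e to x, x′ ∈ N(a) ∩ N(e).
    τ²≤ : ∀ a e → τ a e * τ a e ≤ N * ∑[ c ] (P a c * P c e)
    τ²≤ a e = begin
      τ a e * τ a e                  ≡⟨ cong₂ _*_ τ≡∑t τ≡∑t ⟩
      ∑ t * ∑ t                      ≤⟨ cauchy-schwarz t ⟩
      N * ∑[ c ] (t c * t c)         ≤⟨ *-monoˡ (0≤+ {n}) (∑-mono λ c → *-mono (0≤t c) (0≤P c e) (t≤P c) (t≤P′ c)) ⟩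
      N * ∑[ c ] (P a c * P c e)     ∎
      where
      open ≤-Reasoning
      t : Fin n → ℤ
      t c = ∑[ x ] (B a x * B x e * B x c)
      0≤t : ∀ c → 0ℤ ≤ t c
      0≤t c = ∑-nonneg λ x → 0≤B a x ⊛ 0≤B x e ⊛ 0≤B x c
      τ≡∑t : τ a e ≡ ∑ t
      τ≡∑t = trans (∑-cong λ x → *-distribˡ-∑ (B a x * B x e) (B x)) (∑-comm _)
      drop : ∀ {p q r} → Bit p → Bit q → Bit r → p * q * r ≤ p * r
      drop {p} {q} {r} P Q R = certify (eq p q r) (Bit-0≤ P ⊛ Bit-0≤ R ⊛ Bit-0≤ (Bit-not Q))
        where
        eq : ∀ p q r → p * r - p * q * r ≡ p * r * (1ℤ - q)
        eq = solve-∀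
      t≤P : ∀ c → t c ≤ P a c
      t≤P c = ∑-mono λ x → drop (B-bit a x) (B-bit x e) (B-bit x c)
      t≤P′ : ∀ c → t c ≤ P c e
      t≤P′ c = ∑-mono λ x → subst₂ _≤_ (cong (_* B x c) (*-comm (B x e) (B a x)))
        (trans (*-comm (B x e) (B x c)) (cong (_* B x e) (B-sym x c)))
        (drop (B-bit x e) (B-bit a x) (B-bit x c))

    -- Cauchy-Schwarz over the pairs (a, e) costs N² and `τ²≤` one more N. As `A a e` is idempotent,
    -- the restriction to adjacent pairs survives the squaring.
    Z²≤N³X : Z * Z ≤ N * N * N * X
    Z²≤N³X = begin
      Z * Z                                                       ≤⟨ cauchy-schwarz _ ⟩
      N * ∑[ a ] (∑[ e ] (A a e * τ a e) * ∑[ e ] (A a e * τ a e)) ≤⟨ *-monoˡ (0≤+ {n}) (∑-mono λ a → cauchy-schwarz _) ⟩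
      N * ∑[ a ] (N * ∑[ e ] (A a e * τ a e * (A a e * τ a e)))    ≤⟨ *-monoˡ (0≤+ {n}) (∑-mono λ a → *-monoˡ (0≤+ {n}) (∑-mono λ e → term a e)) ⟩
      N * ∑[ a ] (N * ∑[ e ] (N * (A a e * ∑[ c ] (P a c * P c e)))) ≡⟨ cong (N *_) (trans (∑-cong λ a → cong (N *_) (N ⊡ refl))
                                                                          (N ⊡ (N ⊡ sym X-regroup))) ⟩
      N * (N * (N * X))                                           ≡⟨ eq N X ⟩
      N * N * N * X                                               ∎
      where
      open ≤-Reasoning
      eq : ∀ N X → N * (N * (N * X)) ≡ N * N * N * X
      eq = solve-∀
      square : ∀ a t → a * t * (a * t) ≡ a * a * (t * t)
      square = solve-∀
      swap : ∀ N a p → a * (N * p) ≡ N * (a * p)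
      swap = solve-∀
      term : ∀ a e → A a e * τ a e * (A a e * τ a e) ≤ N * (A a e * ∑[ c ] (P a c * P c e))
      term a e = begin
        A a e * τ a e * (A a e * τ a e)        ≡⟨ square (A a e) (τ a e) ⟩
        A a e * A a e * (τ a e * τ a e)        ≡⟨ cong (_* (τ a e * τ a e)) (Bit-idem (A-bit a e)) ⟩
        A a e * (τ a e * τ a e)                ≤⟨ *-monoˡ (0≤A a e) (τ²≤ a e) ⟩
        A a e * (N * ∑[ c ] (P a c * P c e))   ≡⟨ swap N (A a e) _ ⟩
        N * (A a e * ∑[ c ] (P a c * P c e))   ∎

    module _ (k : ℤ) where

      g : Fin n → ℤ
      g x = k * b x - N

      Γ : ℤ
      Γ = ∑[ x ] (+ ∣ g x ∣)

      y : ℤ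
      y = k * D - (k - 1ℤ) * (N * N)

      -- Variance decomposition: the entries of `g` sum to -y, and their deviations from the mean
      -- are those of `d` times -k.
      N∑g² : N * ∑[ x ] (g x * g x) ≡ k * k * V + y * y
      N∑g² = trans (cong (N *_) (trans (∑-cong λ x → trans (cong (λ r → (k * r - N) * (k * r - N)) (b≡N-d x)) (eq k N (d x)))
          (((k * k) ⊡ refl) ⊞ ((- (+ 2) * k * (k - 1ℤ) * N) ⊡ refl) ⊞ ∑-const n ((k - 1ℤ) * (k - 1ℤ) * (N * N))))) (eq′ k N S D)
        where
        eq : ∀ k N d → (k * (N - d) - N) * (k * (N - d) - N) ≡ k * k * (d * d) + - (+ 2) * k * (k - 1ℤ) * N * d + (k - 1ℤ) * (k - 1ℤ) * (N * N)
        eq = solve-∀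
        eq′ : ∀ k N S D → N * (k * k * S + - (+ 2) * k * (k - 1ℤ) * N * D + N * ((k - 1ℤ) * (k - 1ℤ) * (N * N)))
          ≡ k * k * (N * S - D * D) + (k * D - (k - 1ℤ) * (N * N)) * (k * D - (k - 1ℤ) * (N * N))
        eq′ = solve-∀

      Γ²≤ : Γ * Γ ≤ k * k * V + y * y
      Γ²≤ = begin
        Γ * Γ                                 ≤⟨ cauchy-schwarz _ ⟩
        N * ∑[ x ] (+ ∣ g x ∣ * + ∣ g x ∣)    ≡⟨ cong (N *_) (∑-cong λ x → ∣i∣²≡i² (g x)) ⟩
        N * ∑[ x ] (g x * g x)                ≡⟨ N∑g² ⟩
        k * k * V + y * y                     ∎
        where open ≤-Reasoning

      -- Trading the weight N of a centre x for `k * b x` costs at most `∣ g x ∣`, so each of the N²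
      -- pairs of ends pays at most Γ in total.
      NY≤ : N * Y ≤ k * Z + N * N * Γ
      NY≤ = begin
        N * Y                                                  ≡⟨ N ⊡ refl ⟨
        ∑[ a ] (N * ∑[ e ] (A a e * P a e))                    ≡⟨ ∑-cong (λ a → N ⊡ refl) ⟨
        ∑[ a ] ∑[ e ] (N * (A a e * P a e))                    ≤⟨ ∑-mono (λ a → ∑-mono λ e → pair a e) ⟩
        ∑[ a ] ∑[ e ] (k * (A a e * τ a e) + Γ)                ≡⟨ ∑-cong (λ a → (k ⊡ refl) ⊞ ∑-const n Γ) ⟩
        ∑[ a ] (k * ∑[ e ] (A a e * τ a e) + N * Γ)            ≡⟨ (k ⊡ refl) ⊞ ∑-const n (N * Γ) ⟩
        k * Z + N * (N * Γ)                                    ≡⟨ cong (λ r → k * Z + r) (sym (*-assoc N N Γ)) ⟩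
        k * Z + N * N * Γ                                      ∎
        where
        open ≤-Reasoning
        0≤Γ : 0ℤ ≤ Γ
        0≤Γ = ∑-nonneg λ x → 0≤+ {∣ g x ∣}
        vertex : ∀ {s β α} → Bit s → - (k * β - N) ≤ α → 0ℤ ≤ α → N * s ≤ k * (s * β) + α
        vertex {s} {β} {α} s-bit h 0≤α = certify (eq N k s β α) (Bit-0≤ s-bit ⊛ gap h ⊹ Bit-0≤ (Bit-not s-bit) ⊛ 0≤α)
          where
          eq : ∀ N k s β α → k * (s * β) + α - N * s ≡ s * (α - - (k * β - N)) + (1ℤ - s) * α
          eq = solve-∀
        codegree : ∀ a e → N * P a e ≤ k * τ a e + Γ
        codegree a e = subst₂ _≤_ (N ⊡ refl) ((k ⊡ refl) ⊞ refl)
          (∑-mono λ x → vertex (Bit-* (B-bit a x) (B-bit x e)) (-i≤∣i∣ (g x)) (0≤+ {∣ g x ∣}))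
        pair : ∀ a e → N * (A a e * P a e) ≤ k * (A a e * τ a e) + Γ
        pair a e = certify (eq N k (A a e) (P a e) (τ a e) Γ)
          (0≤A a e ⊛ gap (codegree a e) ⊹ 0≤B a e ⊛ 0≤Γ)
          where
          eq : ∀ N k a p t Γ → k * (a * t) + Γ - N * (a * p) ≡ a * (k * t + Γ - N * p) + (1ℤ - a) * Γ
          eq = solve-∀

  -- Few induced cherries and small degree deviations

  scaled-bounds : ∀ {N X V E} → 1ℤ ≤ N → 0ℤ ≤ E → 0ℤ ≤ X → 0ℤ ≤ V →
    + 16 * (E * X) + + 5 * (E * (N * V)) ≤ + 624 * (N * N * (N * N) * N) →
    E * X ≤ + 39 * (N * N * (N * N) * N) × E * V ≤ + 125 * (N * N * (N * N))
  scaled-bounds {N} {X} {V} {E} 1≤N 0≤E 0≤X 0≤V p =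
    *-cancelˡ {c = + 16} (+≤+ (ℕ.s≤s ℕ.z≤n)) (certify (eq N X V E) (gap p ⊹ 0≤+ {5} ⊛ (0≤E ⊛ (0≤N ⊛ 0≤V)))) ,
    *-cancelˡ {c = + 5 * N} (1≤-* {+ 5} (+≤+ (ℕ.s≤s ℕ.z≤n)) 1≤N)
      (certify (eq′ N X V E) (gap p ⊹ 0≤+ {16} ⊛ (0≤E ⊛ 0≤X) ⊹ 0≤sq N ⊛ 0≤sq N ⊛ 0≤N))
    where
    0≤N = ≤-trans 0≤+ 1≤N
    eq : ∀ N X V E → + 16 * (+ 39 * (N * N * (N * N) * N)) - + 16 * (E * X)
      ≡ + 624 * (N * N * (N * N) * N) - (+ 16 * (E * X) + + 5 * (E * (N * V))) + + 5 * (E * (N * V))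
    eq = solve-∀
    eq′ : ∀ N X V E → + 5 * N * (+ 125 * (N * N * (N * N))) - + 5 * N * (E * V)
      ≡ + 624 * (N * N * (N * N) * N) - (+ 16 * (E * X) + + 5 * (E * (N * V))) + + 16 * (E * X) + N * N * (N * N) * N
    eq′ = solve-∀

  weaken-factor : ∀ {h a c} → 1ℤ ≤ h → 0ℤ ≤ c → h * a ≤ c → a ≤ c
  weaken-factor {h} {a} {c} 1≤h 0≤c p with ≤-total 0ℤ a
  ... | inj₂ a≤0 = ≤-trans a≤0 0≤c
  ... | inj₁ 0≤a = ≤-trans (certify (eq h a) (gap 1≤h ⊛ 0≤a)) p
    where
    eq : ∀ h a → h * a - a ≡ (h - 1ℤ) * a
    eq = solve-∀

  -- Adding (α - Ey)(y + β) and (Ey + α)(β - y) leaves 2αβ - 2Ey². Combining the small bound on Ey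
  -- with the trivial one on y gives y² to first order in 1/E, the order of the bound on V.
  square-bound : ∀ {E y α β} → E * y ≤ α → - α ≤ E * y → y ≤ β → - β ≤ y → E * (y * y) ≤ α * β
  square-bound {E} {y} {α} {β} p q r s = *-cancelˡ {c = + 2} (+≤+ (ℕ.s≤s ℕ.z≤n))
    (certify (eq E y α β) (gap p ⊛ gap s ⊹ gap q ⊛ gap r))
    where
    eq : ∀ E y α β → + 2 * (α * β) - + 2 * (E * (y * y)) ≡ (α - E * y) * (y - - β) + (E * y - - α) * (β - y)
    eq = solve-∀

  sum-square : ∀ {a b c} → 0ℤ ≤ c → c ≤ a + b → c * c ≤ + 2 * (a * a) + + 2 * (b * b)
  sum-square {a} {b} {c} 0≤c p = ≤-trans (*-mono 0≤c (≤-trans 0≤c p) p p) (certify (eq a b) (0≤sq (a - b)))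
    where
    eq : ∀ a b → + 2 * (a * a) + + 2 * (b * b) - (a + b) * (a + b) ≡ (a - b) * (a - b)
    eq = solve-∀

  -- 154 = 125 + 29, the shares of V and y², with k² in the former raised to k⁵.
  Γ-bound : ∀ {E k V y Γ M₄} → 0ℤ ≤ E → 1ℤ ≤ k → 0ℤ ≤ M₄ → Γ * Γ ≤ k * k * V + y * y →
    E * V ≤ + 125 * M₄ → E * (y * y) ≤ + 29 * (k * k * (k * k)) * k * M₄ →
    E * (Γ * Γ) ≤ + 154 * (k * (k * k * (k * k))) * M₄
  Γ-bound {E} {k} {V} {y} {Γ} {M₄} 0≤E 1≤k 0≤M₄ p q r = certify (eq E k V y Γ M₄)
    (0≤E ⊛ gap p ⊹ 0≤sq k ⊛ gap q ⊹ gap r ⊹ 0≤+ {125} ⊛ (0≤sq k ⊛ gap (1≤-* (1≤-* 1≤k 1≤k) 1≤k) ⊛ 0≤M₄))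
    where
    eq : ∀ E k V y Γ M₄ → + 154 * (k * (k * k * (k * k))) * M₄ - E * (Γ * Γ)
      ≡ E * (k * k * V + y * y - Γ * Γ) + k * k * (+ 125 * M₄ - E * V)
        + (+ 29 * (k * k * (k * k)) * k * M₄ - E * (y * y)) + + 125 * (k * k * (k * k * k - 1ℤ) * M₄)
    eq = solve-∀

  -- 386 = 2·39 + 2·154, the shares of Z² and Γ². The bound stays squared until `sq-cancel` takes
  -- the root.
  Y-bound : ∀ {E k N X Y Z Γ} → 0ℤ ≤ E → 1ℤ ≤ k → 0ℤ ≤ N →
    N * Y * (N * Y) ≤ + 2 * (k * Z * (k * Z)) + + 2 * (N * N * Γ * (N * N * Γ)) →
    Z * Z ≤ N * N * N * X → E * X ≤ + 39 * (N * N * (N * N) * N) →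
    E * (Γ * Γ) ≤ + 154 * (k * (k * k * (k * k))) * (N * N * (N * N)) →
    E * (N * Y * (N * Y)) ≤ + 386 * (k * (k * k * (k * k))) * (N * N * (N * N) * (N * N * (N * N)))
  Y-bound {E} {k} {N} {X} {Y} {Z} {Γ} 0≤E 1≤k 0≤N p q r s = certify (eq E k N X Y Z Γ)
    (0≤E ⊛ gap p ⊹ 0≤+ {2} ⊛ (0≤sq k ⊛ 0≤E ⊛ gap q) ⊹ 0≤+ {2} ⊛ (0≤sq k ⊛ (0≤sq N ⊛ 0≤N) ⊛ gap r)
     ⊹ 0≤+ {2} ⊛ (0≤sq N ⊛ 0≤sq N ⊛ gap s)
     ⊹ 0≤+ {78} ⊛ (0≤sq k ⊛ gap (1≤-* (1≤-* 1≤k 1≤k) 1≤k) ⊛ (0≤sq N ⊛ 0≤sq N ⊛ (0≤sq N ⊛ 0≤sq N))))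
    where
    eq : ∀ E k N X Y Z Γ → + 386 * (k * (k * k * (k * k))) * (N * N * (N * N) * (N * N * (N * N))) - E * (N * Y * (N * Y))
      ≡ E * (+ 2 * (k * Z * (k * Z)) + + 2 * (N * N * Γ * (N * N * Γ)) - N * Y * (N * Y))
        + + 2 * (k * k * E * (N * N * N * X - Z * Z))
        + + 2 * (k * k * (N * N * N) * (+ 39 * (N * N * (N * N) * N) - E * X))
        + + 2 * (N * N * (N * N) * (+ 154 * (k * (k * k * (k * k))) * (N * N * (N * N)) - E * (Γ * Γ)))
        + + 78 * (k * k * (k * k * k - 1ℤ) * (N * N * (N * N) * (N * N * (N * N))))
    eq = solve-∀

  unscale : ∀ {L M E W T} → 1ℤ ≤ L → 0ℤ ≤ W → L * (M * M) ≤ E → E * W ≤ L * T → M * M * W ≤ T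
  unscale {L} {M} {E} {W} {T} 1≤L 0≤W p q = *-cancelˡ 1≤L (certify (eq L M E W T) (gap p ⊛ 0≤W ⊹ gap q))
    where
    eq : ∀ L M E W T → L * T - L * (M * M * W) ≡ (E - L * (M * M)) * W + (L * T - E * W)
    eq = solve-∀

  module Small {n : ℕ} (A : Fin n → Fin n → ℤ) (A-sym : ∀ x y → A x y ≡ A y x)
                (A-bit : ∀ x y → Bit (A x y)) (k E M : ℤ) where
    open Cherries A A-sym A-bit

    module _ (1≤N : 1ℤ ≤ N) (3≤k : + 3 ≤ k)
      (M≤E : + 386 * (k * (k * k * (k * k))) * (M * M) ≤ E)
      (many-edges : - (+ 2 * (k * (N * N))) ≤ E * y k)
      (few-C₅ : k * k * (k * k) * (E * C₅) ≤ h₀ k * E * (N * N * (N * N) * N) + + 29 * (k * k * (k * k) * (N * N * (N * N) * N))) where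

      private
        K = k * k * (k * k)
        1≤k : 1ℤ ≤ k
        1≤k = ≤-trans (+≤+ (ℕ.s≤s ℕ.z≤n)) 3≤k
        0≤k = ≤-trans 0≤+ 1≤k
        0≤N : 0ℤ ≤ N
        0≤N = 0≤+
        1≤K : 1ℤ ≤ K
        1≤K = 1≤-* (1≤-* 1≤k 1≤k) (1≤-* 1≤k 1≤k)
        0≤K = ≤-trans 0≤+ 1≤K
        L = + 386 * (k * K)
        1≤L : 1ℤ ≤ L
        1≤L = 1≤-* {+ 386} (+≤+ (ℕ.s≤s ℕ.z≤n)) (1≤-* 1≤k 1≤K)
        0≤E : 0ℤ ≤ E
        0≤E = ≤-trans (≤-trans 0≤+ 1≤L ⊛ 0≤sq M) M≤E

        counting : + 16 * (K * X) + + 16 * (h₀ k * (N * N * (N * N) * N)) + + 16 * (h₁ k * (N * N * N) * y k) + + 5 * (K * (N * V)) ≤ + 16 * (K * C₅)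
        counting = divide-N³ {N} {X} {C₅} {V} {quartic (N * N) D} {y k} K (h₀ k) (h₁ k) 1≤N 0≤K C₅-lower (tangent k (N * N) D)

        EX-EV : E * X ≤ + 39 * (N * N * (N * N) * N) × E * V ≤ + 125 * (N * N * (N * N))
        -- The total from `defect-bound` is 16·29 + 160 = 624, which is 16·39 and less than 5·125.
        EX-EV = scaled-bounds 1≤N 0≤E 0≤X 0≤V (*-cancelˡ 1≤K
          (defect-bound {N} {X} {C₅} {V} {y k} {K} {h₀ k} {h₁ k} {+ 29} {E} {k} 0≤E 0≤N (≤-trans 0≤+ (1≤h₁ 3≤k)) refl (h₁≤5k³ 3≤k) 0≤k
            counting few-C₅ many-edges))

        Ey≤ : E * y k ≤ + 29 * (K * (N * N))
        Ey≤ = weaken-factor (1≤h₁ 3≤k) (0≤+ {29} ⊛ (0≤K ⊛ 0≤sq N))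
          (*-cancelˡ (1≤-* {+ 16} (+≤+ (ℕ.s≤s ℕ.z≤n)) (1≤-* (1≤-* 1≤N 1≤N) 1≤N))
            (excess-bound {N} {X} {C₅} {V} {y k} {K} {h₀ k} {h₁ k} {+ 29} {E} 0≤E 0≤N 0≤K 0≤X 0≤V counting few-C₅))

        ≤Ey : - (+ 29 * (K * (N * N))) ≤ E * y k
        ≤Ey = ≤-trans (certify (eq k N) ((0≤+ {27} ⊛ 0≤K ⊹ 0≤+ {2} ⊛ (0≤k ⊛ gap (1≤-* (1≤-* 1≤k 1≤k) 1≤k))) ⊛ 0≤sq N)) many-edges
          where
          eq : ∀ k N → - (+ 2 * (k * (N * N))) - - (+ 29 * (k * k * (k * k) * (N * N)))
            ≡ (+ 27 * (k * k * (k * k)) + + 2 * (k * (k * k * k - 1ℤ))) * (N * N)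
          eq = solve-∀

        0≤D : 0ℤ ≤ D
        0≤D = ∑-nonneg λ x → ∑-nonneg λ z → 0≤A x z
        D≤N² : D ≤ N * N
        D≤N² = ∑-bound λ x → ≤-trans (∑-bound λ z → Bit-≤1 (A-bit x z)) (≤-reflexive (*-identityʳ N))

        y≤ : y k ≤ k * (N * N)
        y≤ = certify (eq k N D) (0≤k ⊛ gap D≤N² ⊹ gap 1≤k ⊛ 0≤sq N)
          where
          eq : ∀ k N D → k * (N * N) - (k * D - (k - 1ℤ) * (N * N)) ≡ k * (N * N - D) + (k - 1ℤ) * (N * N)
          eq = solve-∀
        ≤y : - (k * (N * N)) ≤ y k
        ≤y = certify (eq k N D) (0≤k ⊛ 0≤D ⊹ 0≤sq N)
          where
          eq : ∀ k N D → (k * D - (k - 1ℤ) * (N * N)) - - (k * (N * N)) ≡ k * D + N * N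
          eq = solve-∀

        Ey² : E * (y k * y k) ≤ + 29 * K * k * (N * N * (N * N))
        Ey² = ≤-trans (square-bound {E} {y k} Ey≤ ≤Ey y≤ ≤y) (≤-reflexive (eq k K (N * N)))
          where
          eq : ∀ k K M → + 29 * (K * M) * (k * M) ≡ + 29 * K * k * (M * M)
          eq = solve-∀

        EΓ² : E * (Γ k * Γ k) ≤ + 154 * (k * K) * (N * N * (N * N))
        EΓ² = Γ-bound {E} {k} {V} {y k} {Γ k} {N * N * (N * N)} 0≤E 1≤k (0≤sq N ⊛ 0≤sq N) (Γ²≤ k) (proj₂ EX-EV) Ey²

        0≤Y : 0ℤ ≤ Y
        0≤Y = ∑-nonneg λ a → ∑-nonneg λ e → 0≤A a e ⊛ 0≤P a e

      MΓ≤N² : M * Γ k ≤ N * N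
      MΓ≤N² = sq-cancel (0≤sq N) (≤-trans (≤-reflexive (eq M (Γ k)))
        (unscale {L} {M} {E} 1≤L (0≤sq (Γ k)) M≤E (≤-trans EΓ² (certify (eq′ (k * K) (N * N * (N * N))) (0≤+ {232} ⊛ (0≤k ⊛ 0≤K ⊛ (0≤sq N ⊛ 0≤sq N)))))))
        where
        eq : ∀ M Γ → M * Γ * (M * Γ) ≡ M * M * (Γ * Γ)
        eq = solve-∀
        eq′ : ∀ L T → + 386 * L * T - + 154 * L * T ≡ + 232 * (L * T)
        eq′ = solve-∀

      MY≤N³ : M * Y ≤ N * N * N
      MY≤N³ = *-cancelˡ 1≤N (sq-cancel (0≤N ⊛ (0≤sq N ⊛ 0≤N)) (≤-trans (≤-reflexive (eq M N Y))
        (≤-trans (unscale {L} {M} {E} 1≤L (0≤sq (N * Y)) M≤E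
          (Y-bound {E} {k} {N} {X} {Y} {Z} {Γ k} 0≤E 1≤k 0≤N (sum-square {k * Z} {N * N * Γ k} {N * Y} (0≤N ⊛ 0≤Y) (NY≤ k)) Z²≤N³X (proj₁ EX-EV) EΓ²))
          (≤-reflexive (eq′ N)))))
        where
        eq : ∀ M N Y → N * (M * Y) * (N * (M * Y)) ≡ M * M * (N * Y * (N * Y))
        eq = solve-∀
        eq′ : ∀ N → N * N * (N * N) * (N * N * (N * N)) ≡ N * (N * N * N) * (N * (N * N * N))
        eq′ = solve-∀

  -- Clustering the complement

  ind : ∀ {p} {P : Set p} → Dec P → ℤ
  ind (yes _) = 1ℤ
  ind (no _)  = 0ℤ

  ind-yes : ∀ {p} {P : Set p} (P? : Dec P) → P → ind P? ≡ 1ℤ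
  ind-yes (yes _) _ = refl
  ind-yes (no ¬p) p = contradiction p ¬p

  ind-no : ∀ {p} {P : Set p} (P? : Dec P) → ¬ P → ind P? ≡ 0ℤ
  ind-no (yes p) ¬p = contradiction p ¬p
  ind-no (no _) _ = refl

  ind-bit : ∀ {p} {P : Set p} (P? : Dec P) → Bit (ind P?)
  ind-bit (yes _) = inj₂ refl
  ind-bit (no _) = inj₁ refl

  -- Colour k marks the vertices that are not yet clustered; pairs of such vertices are not charged.
  disagree : ℕ → ℕ → ℕ → ℤ → ℤ
  disagree k a b s = if does (a ℕ.≟ k) ∧ does (b ℕ.≟ k) then 0ℤ else if does (a ℕ.≟ b) then s else 1ℤ - s

  disagree-rest : ∀ k s → disagree k k k s ≡ 0ℤ
  disagree-rest k s rewrite dec-true (k ℕ.≟ k) refl = refl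

  disagree-same : ∀ {k a} s → a ≢ k → disagree k a a s ≡ s
  disagree-same {k} {a} s a≢k rewrite dec-false (a ℕ.≟ k) a≢k | dec-true (a ℕ.≟ a) refl = refl

  disagree-diff : ∀ {k a b} s → a ≢ b → disagree k a b s ≡ 1ℤ - s
  disagree-diff {k} {a} {b} s a≢b with a ℕ.≟ k
  ... | no a≢k rewrite dec-false (a ℕ.≟ k) a≢k | dec-false (a ℕ.≟ b) a≢b = refl
  ... | yes refl rewrite dec-true (a ℕ.≟ a) refl | dec-false (b ℕ.≟ a) (≢-sym a≢b) | dec-false (a ℕ.≟ b) a≢b = refl

  disagree-nonneg : ∀ k a b {s} → Bit s → 0ℤ ≤ disagree k a b s
  disagree-nonneg k a b {s} s-bit with does (a ℕ.≟ k) ∧ does (b ℕ.≟ k) | does (a ℕ.≟ b)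
  ... | true | _ = 0≤+
  ... | false | true = Bit-0≤ s-bit
  ... | false | false = Bit-0≤ (Bit-not s-bit)

  -- The decision and the bit are arguments so that the lemmas can split on them directly. `inj₁`
  -- means not adjacent to the new centre, that is, a complement neighbour of it.
  recolour : ∀ {P : Set} {r} → ℕ → ℕ → Dec P → Bit r → ℕ
  recolour j a (yes _) (inj₁ _) = j
  recolour j a (yes _) (inj₂ _) = a
  recolour j a (no _)  _        = a

  module _ {j k : ℕ} (j<k : j ℕ.< k) where

    j≢k : j ≢ k
    j≢k = ℕ.<⇒≢ j<k

    recolour-colours : ∀ {a p} → a ℕ.< j ⊎ a ≡ k → (a? : Dec (a ≡ k)) (p-bit : Bit p) →
      recolour j a a? p-bit ℕ.< suc j ⊎ recolour j a a? p-bit ≡ k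
    recolour-colours _ (yes _) (inj₁ _) = inj₁ ℕ.≤-refl
    recolour-colours _ (yes a≡k) (inj₂ _) = inj₂ a≡k
    recolour-colours (inj₁ a<j) (no _) _ = inj₁ (ℕ.m≤n⇒m≤1+n a<j)
    recolour-colours (inj₂ a≡k) (no _) _ = inj₂ a≡k

    ind-recolour-new : ∀ {a p} → a ℕ.< j ⊎ a ≡ k → (a? : Dec (a ≡ k)) (p-bit : Bit p) →
      ind (recolour j a a? p-bit ℕ.≟ j) ≡ ind a? * (1ℤ - p)
    ind-recolour-new _ (yes _) (inj₁ refl) = ind-yes (j ℕ.≟ j) refl
    ind-recolour-new {a} _ (yes refl) (inj₂ refl) = ind-no (a ℕ.≟ j) (≢-sym j≢k)
    ind-recolour-new {a} (inj₁ a<j) (no _) _ = ind-no (a ℕ.≟ j) (ℕ.<⇒≢ a<j)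
    ind-recolour-new (inj₂ a≡k) (no a≢k) _ = contradiction a≡k a≢k

    ind-recolour-rest : ∀ {a p} (a? : Dec (a ≡ k)) (p-bit : Bit p) →
      ind (recolour j a a? p-bit ℕ.≟ k) ≡ ind a? * p
    ind-recolour-rest (yes _) (inj₁ refl) = ind-no (j ℕ.≟ k) j≢k
    ind-recolour-rest {a} (yes a≡k) (inj₂ refl) = ind-yes (a ℕ.≟ k) a≡k
    ind-recolour-rest {a} (no a≢k) _ = ind-no (a ℕ.≟ k) a≢k

    ind-recolour-old : ∀ {a p i} → i ℕ.< j → (a? : Dec (a ≡ k)) (p-bit : Bit p) →
      ind (recolour j a a? p-bit ℕ.≟ i) ≡ ind (a ℕ.≟ i)
    ind-recolour-old {a} {i = i} i<j (yes refl) (inj₁ _) =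
      trans (ind-no (j ℕ.≟ i) (≢-sym (ℕ.<⇒≢ i<j))) (sym (ind-no (a ℕ.≟ i) (≢-sym (ℕ.<⇒≢ (ℕ.<-trans i<j j<k)))))
    ind-recolour-old i<j (yes _) (inj₂ _) = refl
    ind-recolour-old i<j (no _) _ = refl

    -- `p` and `q` record adjacency to the new centre, `s` that of the pair. Pairs meeting an
    -- earlier cluster keep their charge. A new charge arises only inside the rest: two complement
    -- neighbours of the centre that are adjacent, or a complement neighbour cut off from a vertex
    -- that it misses but the centre does not. Either way the pair and the centre form an induced
    -- cherry of the complement.
    disagree-recolour : ∀ {a b p q s} → a ℕ.< j ⊎ a ≡ k → b ℕ.< j ⊎ b ≡ k →
      (a? : Dec (a ≡ k)) (b? : Dec (b ≡ k)) (p-bit : Bit p) (q-bit : Bit q) → Bit s →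
      disagree k (recolour j a a? p-bit) (recolour j b b? q-bit) s
        ≤ disagree k a b s + ((1ℤ - p) * (1ℤ - q) * s + (1ℤ - p) * (1ℤ - s) * q + (1ℤ - q) * (1ℤ - s) * p)
    disagree-recolour {a} {b} {p} {q} {s} ha hb a? b? p-bit q-bit s-bit = go ha hb a? b? p-bit q-bit
      where
      δ = (1ℤ - p) * (1ℤ - q) * s + (1ℤ - p) * (1ℤ - s) * q + (1ℤ - q) * (1ℤ - s) * p
      p̄ = Bit-0≤ (Bit-not p-bit)
      q̄ = Bit-0≤ (Bit-not q-bit)
      s̄ = Bit-0≤ (Bit-not s-bit)
      0≤δ : 0ℤ ≤ δ
      0≤δ = p̄ ⊛ q̄ ⊛ Bit-0≤ s-bit ⊹ p̄ ⊛ s̄ ⊛ Bit-0≤ q-bit ⊹ q̄ ⊛ s̄ ⊛ Bit-0≤ p-bit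
      keep : ∀ {x z} → x ≡ z → x ≤ z + δ
      keep {x} refl = subst (_≤ x + δ) (+-identityʳ x) (+-monoʳ-≤ x 0≤δ)
      fresh : ∀ {x z} → x ≡ z → z ≡ δ → x ≤ disagree k k k s + δ
      fresh refl refl = ≤-reflexive (sym (trans (cong (_+ δ) (disagree-rest k s)) (+-identityˡ δ)))
      go : a ℕ.< j ⊎ a ≡ k → b ℕ.< j ⊎ b ≡ k → (a? : Dec (a ≡ k)) (b? : Dec (b ≡ k)) (p-bit : Bit p) (q-bit : Bit q) →
        disagree k (recolour j a a? p-bit) (recolour j b b? q-bit) s ≤ disagree k a b s + δ
      go (inj₂ a≡k) _ (no a≢k) _ _ _ = contradiction a≡k a≢k
      go _ (inj₂ b≡k) _ (no b≢k) _ _ = contradiction b≡k b≢k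
      go (inj₁ a<j) _ (yes refl) _ _ _ = contradiction j<k (ℕ.<⇒≯ a<j)
      go _ (inj₁ b<j) _ (yes refl) _ _ = contradiction j<k (ℕ.<⇒≯ b<j)
      go (inj₁ _) (inj₁ _) (no _) (no _) _ _ = keep refl
      go (inj₁ a<j) (inj₂ _) (no a≢k) (yes refl) _ (inj₁ _) = keep (trans (disagree-diff s (ℕ.<⇒≢ a<j)) (sym (disagree-diff s a≢k)))
      go (inj₁ _) (inj₂ _) (no _) (yes refl) _ (inj₂ _) = keep refl
      go (inj₂ _) (inj₁ b<j) (yes refl) (no b≢k) (inj₁ _) _ = keep (trans (disagree-diff s (≢-sym (ℕ.<⇒≢ b<j))) (sym (disagree-diff s (≢-sym b≢k))))
      go (inj₂ _) (inj₁ _) (yes refl) (no _) (inj₂ _) _ = keep refl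
      go (inj₂ _) (inj₂ _) (yes refl) (yes refl) (inj₁ refl) (inj₁ refl) = fresh (disagree-same s j≢k) (eq s)
        where
        eq : ∀ s → s ≡ (1ℤ - 0ℤ) * (1ℤ - 0ℤ) * s + (1ℤ - 0ℤ) * (1ℤ - s) * 0ℤ + (1ℤ - 0ℤ) * (1ℤ - s) * 0ℤ
        eq = solve-∀
      go (inj₂ _) (inj₂ _) (yes refl) (yes refl) (inj₁ refl) (inj₂ refl) = fresh (disagree-diff s j≢k) (eq s)
        where
        eq : ∀ s → 1ℤ - s ≡ (1ℤ - 0ℤ) * (1ℤ - 1ℤ) * s + (1ℤ - 0ℤ) * (1ℤ - s) * 1ℤ + (1ℤ - 1ℤ) * (1ℤ - s) * 0ℤ
        eq = solve-∀
      go (inj₂ _) (inj₂ _) (yes refl) (yes refl) (inj₂ refl) (inj₁ refl) = fresh (disagree-diff s (≢-sym j≢k)) (eq s)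
        where
        eq : ∀ s → 1ℤ - s ≡ (1ℤ - 1ℤ) * (1ℤ - 0ℤ) * s + (1ℤ - 1ℤ) * (1ℤ - s) * 0ℤ + (1ℤ - 0ℤ) * (1ℤ - s) * 1ℤ
        eq = solve-∀
      go (inj₂ _) (inj₂ _) (yes refl) (yes refl) (inj₂ refl) (inj₂ refl) = keep refl

  size : ∀ {n} → (Fin n → ℕ) → ℕ → ℤ
  size c i = ∑[ x ] ind (c x ℕ.≟ i)

  2≤20κ² : ∀ {κ} → 1ℤ ≤ κ → + 2 ≤ + 20 * (κ * κ)
  2≤20κ² {κ} 1≤κ = certify (eq κ) (0≤+ {20} ⊛ gap (1≤-* 1≤κ 1≤κ) ⊹ 0≤+ {18})
    where
    eq : ∀ κ → + 20 * (κ * κ) - + 2 ≡ + 20 * (κ * κ - 1ℤ) + + 18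
    eq = solve-∀

  -- Each clustering step costs a factor 20κ² in precision.
  weight : ℤ → ℕ → ℤ → ℤ
  weight κ zero    W = W
  weight κ (suc j) W = weight κ j (+ 20 * (κ * κ) * W)

  W≤weight : ∀ {κ} j {W} → 1ℤ ≤ κ → 1ℤ ≤ W → W ≤ weight κ j W
  W≤weight zero 1≤κ 1≤W = ≤-refl
  W≤weight {κ} (suc j) {W} 1≤κ 1≤W = ≤-trans
    (certify (eq κ W) ((0≤+ {20} ⊛ gap (1≤-* 1≤κ 1≤κ) ⊹ 0≤+ {19}) ⊛ ≤-trans 0≤+ 1≤W))
    (W≤weight j 1≤κ (1≤-* (1≤-* {+ 20} (+≤+ (ℕ.s≤s ℕ.z≤n)) (1≤-* 1≤κ 1≤κ)) 1≤W))
    where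
    eq : ∀ κ W → + 20 * (κ * κ) * W - W ≡ (+ 20 * (κ * κ - 1ℤ) + + 19) * W
    eq = solve-∀

  half-weight : ∀ {κ W a T} → 1ℤ ≤ κ → 0ℤ ≤ T → + 20 * (κ * κ) * W * a ≤ T → + 2 * (W * a) ≤ T
  half-weight {κ} {W} {a} {T} 1≤κ 0≤T p =
    weaken-factor {+ 10 * (κ * κ)} (1≤-* {+ 10} (+≤+ (ℕ.s≤s ℕ.z≤n)) (1≤-* 1≤κ 1≤κ)) 0≤T
      (subst (_≤ T) (eq κ W a) p)
    where
    eq : ∀ κ W a → + 20 * (κ * κ) * W * a ≡ + 10 * (κ * κ) * (+ 2 * (W * a))
    eq = solve-∀

  -- Before the last round ends, the rest should hold at least N/κ vertices, and the accuracy
  -- forfeits at most half of them. Averaging over the rest thus loses only a factor 2κ.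
  rest-large : ∀ {κ W j N ρ} → 1ℤ ≤ κ → 1ℤ ≤ W → 0ℤ ≤ N → j + 1ℤ ≤ κ →
    + 20 * (κ * κ) * W * ((κ - j) * N - κ * ρ) ≤ N → N ≤ + 2 * (κ * ρ)
  rest-large {κ} {W} {j} {N} {ρ} 1≤κ 1≤W 0≤N j<κ p =
    certify (eq κ j N ρ) (gap (weaken-factor 1≤W 0≤N (subst (_≤ N) (swap W ((κ - j) * N - κ * ρ)) (half-weight {κ} {W} 1≤κ 0≤N p)))
      ⊹ 0≤+ {2} ⊛ (gap j<κ ⊛ 0≤N))
    where
    swap : ∀ W t → + 2 * (W * t) ≡ W * (+ 2 * t)
    swap = solve-∀
    eq : ∀ κ j N ρ → + 2 * (κ * ρ) - N ≡ N - + 2 * ((κ - j) * N - κ * ρ) + + 2 * ((κ - (j + 1ℤ)) * N)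
    eq = solve-∀

  -- Origin of 20κ²: 1 + 3 + 1 from the three terms, 2κ from N/ρ, and 2κ left in the conclusion.
  -- There κ converts cost into a deviation of class size, and 2 lets an old and a new error share
  -- one allowance.
  cost-bound : ∀ {κ W N ρ cost Γ Y Err} → 1ℤ ≤ κ → 0ℤ ≤ W → 1ℤ ≤ N → 0ℤ ≤ cost → N ≤ + 2 * (κ * ρ) →
    ρ * cost ≤ N * Γ + + 3 * Y + N * Err →
    + 20 * (κ * κ) * W * Γ ≤ N * N → + 20 * (κ * κ) * W * Y ≤ N * N * N → + 20 * (κ * κ) * W * Err ≤ N * N →
    + 2 * (κ * (W * cost)) ≤ N * N
  cost-bound {κ} {W} {N} {ρ} {cost} {Γ} {Y} {Err} 1≤κ 0≤W 1≤N 0≤c N≤ p q r s =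
    *-cancelˡ (1≤-* 1≤N (1≤-* {+ 10} (+≤+ (ℕ.s≤s ℕ.z≤n)) 1≤κ)) (certify (eq κ W N ρ cost Γ Y Err)
      (0≤+ {2} ⊛ (0≤κ ⊛ 0≤N ⊛ gap q) ⊹ 0≤+ {6} ⊛ (0≤κ ⊛ gap r) ⊹ 0≤+ {2} ⊛ (0≤κ ⊛ 0≤N ⊛ gap s)
       ⊹ 0≤+ {40} ⊛ (0≤κ ⊛ 0≤sq κ ⊛ 0≤W ⊛ gap p) ⊹ 0≤+ {20} ⊛ (0≤sq κ ⊛ 0≤W ⊛ 0≤c ⊛ gap N≤)))
    where
    0≤κ = ≤-trans 0≤+ 1≤κ
    0≤N = ≤-trans 0≤+ 1≤N
    eq : ∀ κ W N ρ cost Γ Y Err →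
      N * (+ 10 * κ) * (N * N) - N * (+ 10 * κ) * (+ 2 * (κ * (W * cost)))
      ≡ + 2 * (κ * N * (N * N - + 20 * (κ * κ) * W * Γ)) + + 6 * (κ * (N * N * N - + 20 * (κ * κ) * W * Y))
        + + 2 * (κ * N * (N * N - + 20 * (κ * κ) * W * Err))
        + + 40 * (κ * (κ * κ) * W * (N * Γ + + 3 * Y + N * Err - ρ * cost))
        + + 20 * (κ * κ * W * cost * (+ 2 * (κ * ρ) - N))
    eq = solve-∀

  err-bound : ∀ {κ W N cost Err Err′} → 1ℤ ≤ κ → 0ℤ ≤ W → 0ℤ ≤ N → 0ℤ ≤ cost → Err′ ≤ Err + cost →
    + 20 * (κ * κ) * W * Err ≤ N * N → + 2 * (κ * (W * cost)) ≤ N * N → W * Err′ ≤ N * N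
  err-bound {κ} {W} {N} {cost} {Err} {Err′} 1≤κ 0≤W 0≤N 0≤c p q r = *-cancelˡ {c = + 2} (+≤+ (ℕ.s≤s ℕ.z≤n))
    (certify (eq κ W N cost Err Err′) (0≤+ {2} ⊛ (0≤W ⊛ gap p) ⊹ gap (half-weight {κ} {W} 1≤κ (0≤sq N) q) ⊹ gap r
      ⊹ 0≤+ {2} ⊛ (gap 1≤κ ⊛ (0≤W ⊛ 0≤c))))
    where
    eq : ∀ κ W N cost Err Err′ → + 2 * (N * N) - + 2 * (W * Err′)
      ≡ + 2 * (W * (Err + cost - Err′)) + (N * N - + 2 * (W * Err)) + (N * N - + 2 * (κ * (W * cost)))
        + + 2 * ((κ - 1ℤ) * (W * cost))
    eq = solve-∀

  -- ∣κ·size − N∣ ≤ ∣g∣ + κ·T ≤ κ·cost / N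
  class-bound : ∀ {κ W N cost t γ T Y} → 1ℤ ≤ κ → 0ℤ ≤ W → 1ℤ ≤ N → 0ℤ ≤ γ → 0ℤ ≤ Y →
    cost ≡ N * γ + Y + N * T → t ≤ γ + κ * T → + 2 * (κ * (W * cost)) ≤ N * N → + 2 * (W * t) ≤ N
  class-bound {κ} {W} {N} {_} {t} {γ} {T} {Y} 1≤κ 0≤W 1≤N 0≤γ 0≤Y refl p q = *-cancelˡ 1≤N
    (certify (eq κ W N t γ T Y) (gap q ⊹ 0≤+ {2} ⊛ (0≤N ⊛ (0≤W ⊛ gap p)) ⊹ 0≤+ {2} ⊛ (0≤W ⊛ (gap 1≤κ ⊛ (0≤N ⊛ 0≤γ)))
      ⊹ 0≤+ {2} ⊛ (0≤κ ⊛ 0≤W ⊛ 0≤Y)))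
    where
    0≤κ = ≤-trans 0≤+ 1≤κ
    0≤N = ≤-trans 0≤+ 1≤N
    eq : ∀ κ W N t γ T Y → N * N - N * (+ 2 * (W * t))
      ≡ N * N - + 2 * (κ * (W * (N * γ + Y + N * T))) + + 2 * (N * (W * (γ + κ * T - t)))
        + + 2 * (W * ((κ - 1ℤ) * (N * γ))) + + 2 * (κ * W * Y)
    eq = solve-∀

  average-halves : ∀ {W s t N} → + 2 * (W * s) ≤ N → + 2 * (W * t) ≤ N → W * (s + t) ≤ N
  average-halves {W} {s} {t} {N} p q = *-cancelˡ {c = + 2} (+≤+ (ℕ.s≤s ℕ.z≤n)) (certify (eq W s t N) (gap p ⊹ gap q))
    where
    eq : ∀ W s t N → + 2 * N - + 2 * (W * (s + t)) ≡ N - + 2 * (W * s) + (N - + 2 * (W * t))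
    eq = solve-∀

  module Clusters {n : ℕ} (A : Fin n → Fin n → ℤ) (A-sym : ∀ x y → A x y ≡ A y x)
                (A-bit : ∀ x y → Bit (A x y)) (k : ℕ) (1≤k : 1 ℕ.≤ k) (1≤n : 1 ℕ.≤ n) where
    open Cherries A A-sym A-bit

    κ = + k

    Err : (Fin n → ℕ) → ℤ
    Err c = ∑[ x ] ∑[ y ] disagree k (c x) (c y) (A x y)

    -- W is the inverse of the permitted relative error.
    record Clustered (j : ℕ) (W : ℤ) (c : Fin n → ℕ) : Set where
      field
        colours   : ∀ x → c x ℕ.< j ⊎ c x ≡ k
        err-small : W * Err c ≤ N * N
        classes   : ∀ i → i ℕ.< j → W * (N - κ * size c i) ≤ N
        rest      : W * ((κ - + j) * N - κ * size c k) ≤ N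

    module Step {j : ℕ} (j<k : j ℕ.< k) {W : ℤ} (1≤W : 1ℤ ≤ W)
      (Γ-small : + 20 * (κ * κ) * W * Γ κ ≤ N * N) (Y-small : + 20 * (κ * κ) * W * Y ≤ N * N * N)
      {c : Fin n → ℕ} (I : Clustered j (+ 20 * (κ * κ) * W) c) where
      open Clustered I

      -- The unclustered complement neighbours of an unclustered vertex of at most average cost form the next cluster.
      r T Y₁ Y₂ cost : Fin n → ℤ
      r x = ind (c x ℕ.≟ k)
      T v = ∑[ x ] (B v x * (1ℤ - r x))
      Y₁ v = ∑[ x ] ∑[ y ] (B v x * B v y * A x y)
      Y₂ v = ∑[ x ] ∑[ y ] (B v x * B x y * A v y)
      cost v = N * + ∣ g κ v ∣ + (Y₁ v + + 2 * Y₂ v) + N * T v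

      private
        1≤κ : 1ℤ ≤ κ
        1≤κ = +≤+ 1≤k
        1≤N : 1ℤ ≤ N
        1≤N = +≤+ 1≤n
        0≤N = 0≤+ {n}
        0≤W = ≤-trans 0≤+ 1≤W
        r-bit : ∀ x → Bit (r x)
        r-bit x = ind-bit (c x ℕ.≟ k)
        0≤Y₁ : ∀ v → 0ℤ ≤ Y₁ v
        0≤Y₁ v = ∑-nonneg λ x → ∑-nonneg λ z → 0≤B v x ⊛ 0≤B v z ⊛ 0≤A x z
        0≤Y₂ : ∀ v → 0ℤ ≤ Y₂ v
        0≤Y₂ v = ∑-nonneg λ x → ∑-nonneg λ z → 0≤B v x ⊛ 0≤B x z ⊛ 0≤A v z
        0≤T : ∀ v → 0ℤ ≤ T v
        0≤T v = ∑-nonneg λ x → 0≤B v x ⊛ Bit-0≤ (Bit-not (r-bit x))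
        0≤cost : ∀ v → 0ℤ ≤ cost v
        0≤cost v = 0≤N ⊛ 0≤+ {∣ g κ v ∣} ⊹ (0≤Y₁ v ⊹ 0≤+ {2} ⊛ 0≤Y₂ v) ⊹ 0≤N ⊛ 0≤T v

        rotate : ∀ a b c → a * b * c ≡ c * (a * b)
        rotate = solve-∀

        ∑Y₁ : ∑ Y₁ ≡ Y
        ∑Y₁ = begin
          ∑[ v ] ∑[ x ] ∑[ z ] (B v x * B v z * A x z)   ≡⟨ ∑-comm _ ⟩
          ∑[ x ] ∑[ v ] ∑[ z ] (B v x * B v z * A x z)   ≡⟨ ∑-cong (λ x → ∑-comm _) ⟩
          ∑[ x ] ∑[ z ] ∑[ v ] (B v x * B v z * A x z)   ≡⟨ ∑-cong (λ x → ∑-cong λ z → trans (∑-cong λ v →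
                trans (cong (λ b → b * B v z * A x z) (B-sym v x)) (rotate (B x v) (B v z) (A x z))) (A x z ⊡ refl)) ⟩
          Y ∎
          where open ≡-Reasoning

        ∑Y₂ : ∑ Y₂ ≡ Y
        ∑Y₂ = ∑-cong λ v → trans (∑-comm _) (∑-cong λ z → trans (∑-cong λ x → rotate (B v x) (B x z) (A v z)) (A v z ⊡ refl))

        ∑rT≤Err : ∑[ v ] (r v * T v) ≤ Err c
        ∑rT≤Err = ∑-mono λ v → ≤-trans (≤-reflexive (*-distribˡ-∑ (r v) _)) (∑-mono λ x → pair v x)
          where
          pair : ∀ v x → r v * (B v x * (1ℤ - r x)) ≤ disagree k (c v) (c x) (A v x)
          pair v x with c v ℕ.≟ k | c x ℕ.≟ k
          ... | no _  | _     = disagree-nonneg k (c v) (c x) (A-bit v x)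
          ... | yes _ | yes _ = ≤-trans (≤-reflexive (trans (*-identityˡ _) (*-zeroʳ (B v x)))) (disagree-nonneg k (c v) (c x) (A-bit v x))
          ... | yes cv≡k | no cx≢k = ≤-reflexive (trans (trans (*-identityˡ _) (*-identityʳ (B v x)))
                (sym (disagree-diff (A v x) λ cv≡cx → cx≢k (trans (sym cv≡cx) cv≡k))))

        -- Dropping `r` is affordable for the degree and cherry terms, but not for `T`: complement
        -- edges between the rest and the clusters are charged in `Err`, those inside a cluster are
        -- not.
        total : ∑[ v ] (r v * cost v) ≤ N * Γ κ + + 3 * Y + N * Err c
        total = begin
          ∑[ v ] (r v * cost v)                                                          ≤⟨ ∑-mono drop-r ⟩
          ∑[ v ] (N * + ∣ g κ v ∣ + (Y₁ v + + 2 * Y₂ v) + N * (r v * T v))               ≡⟨ (N ⊡ refl) ⊞ (∑Y₁ ⊞ (+ 2 ⊡ ∑Y₂)) ⊞ (N ⊡ refl) ⟩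
          N * Γ κ + (Y + + 2 * Y) + N * ∑[ v ] (r v * T v)                               ≤⟨ +-mono-≤ (≤-reflexive (cong (λ z → N * Γ κ + z) (eq Y))) (*-monoˡ 0≤N ∑rT≤Err) ⟩
          N * Γ κ + + 3 * Y + N * Err c                                                  ∎
          where
          open ≤-Reasoning
          eq : ∀ Y → Y + + 2 * Y ≡ + 3 * Y
          eq = solve-∀
          eq′ : ∀ r γ y t N → N * γ + y + N * (r * t) - r * (N * γ + y + N * t) ≡ (1ℤ - r) * (N * γ + y)
          eq′ = solve-∀
          drop-r : ∀ v → r v * cost v ≤ N * + ∣ g κ v ∣ + (Y₁ v + + 2 * Y₂ v) + N * (r v * T v)
          drop-r v = certify (eq′ (r v) (+ ∣ g κ v ∣) (Y₁ v + + 2 * Y₂ v) (T v) N)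
            (Bit-0≤ (Bit-not (r-bit v)) ⊛ (0≤N ⊛ 0≤+ {∣ g κ v ∣} ⊹ (0≤Y₁ v ⊹ 0≤+ {2} ⊛ 0≤Y₂ v)))

        N≤2κρ : N ≤ + 2 * (κ * ∑ r)
        N≤2κρ = rest-large {κ} {W} {+ j} {N} {∑ r} 1≤κ 1≤W 0≤N (+≤+ (subst (ℕ._≤ k) (ℕ.+-comm 1 j) j<k)) rest

        1≤ρ : 1ℤ ≤ ∑ r
        1≤ρ with 1ℤ ≤? ∑ r
        ... | yes p = p
        ... | no ¬p = contradiction (≤-trans 1≤N (≤-trans N≤2κρ (≤-reflexive (trans (cong (λ z → + 2 * (κ * z)) ρ≡0) (trans (cong (+ 2 *_) (*-zeroʳ κ)) refl))))) λ { (+≤+ ()) }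
          where
          ρ≡0 : ∑ r ≡ 0ℤ
          ρ≡0 = ≤-antisym (i<j⇒i≤pred[j] (≰⇒> ¬p)) (∑-nonneg λ x → Bit-0≤ (r-bit x))

        chosen : ∃ λ v → r v ≡ 1ℤ × ∑ r * cost v ≤ N * Γ κ + + 3 * Y + N * Err c
        chosen = ∃-≤-average r cost r-bit 1≤ρ total

      module Recolour (ν : Fin n) (small-cost : ∑ r * cost ν ≤ N * Γ κ + + 3 * Y + N * Err c) where

        private
          cost-small : + 2 * (κ * (W * cost ν)) ≤ N * N
          cost-small = cost-bound {κ} {W} {N} {∑ r} {cost ν} {Γ κ} {Y} {Err c} 1≤κ 0≤W 1≤N (0≤cost ν) N≤2κρ
            small-cost Γ-small Y-small err-small

        c′ : Fin n → ℕ
        c′ x = recolour j (c x) (c x ℕ.≟ k) (A-bit ν x)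

        private
          Err′≤ : Err c′ ≤ Err c + cost ν
          Err′≤ = begin
            Err c′ ≤⟨ ∑-mono (λ x → ∑-mono λ z → disagree-recolour j<k (colours x) (colours z) (c x ℕ.≟ k) (c z ℕ.≟ k) (A-bit ν x) (A-bit ν z) (A-bit x z)) ⟩
            ∑[ x ] ∑[ z ] (disagree k (c x) (c z) (A x z) + (B ν x * B ν z * A x z + B ν x * B x z * A ν z + B ν z * B x z * A ν x))
              ≡⟨ ∑-cong (λ x → refl ⊞ (refl ⊞ refl ⊞ refl)) ⟩
            ∑[ x ] (∑[ z ] disagree k (c x) (c z) (A x z) + (∑[ z ] (B ν x * B ν z * A x z) + ∑[ z ] (B ν x * B x z * A ν z) + ∑[ z ] (B ν z * B x z * A ν x)))
              ≡⟨ refl ⊞ (refl ⊞ refl ⊞ Y₂-sym) ⟩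
            Err c + (Y₁ ν + Y₂ ν + Y₂ ν) ≤⟨ +-monoʳ-≤ (Err c) (certify (eq N (+ ∣ g κ ν ∣) (Y₁ ν) (Y₂ ν) (T ν)) (0≤N ⊛ 0≤+ {∣ g κ ν ∣} ⊹ 0≤N ⊛ 0≤T ν)) ⟩
            Err c + cost ν ∎
            where
            open ≤-Reasoning
            Y₂-sym : ∑[ x ] ∑[ z ] (B ν z * B x z * A ν x) ≡ Y₂ ν
            Y₂-sym = trans (∑-comm _) (∑-cong λ z → ∑-cong λ x → cong (λ b → B ν z * b * A ν x) (B-sym x z))
            eq : ∀ N γ y₁ y₂ t → N * γ + (y₁ + + 2 * y₂) + N * t - (y₁ + y₂ + y₂) ≡ N * γ + N * t
            eq = solve-∀

          size-new : size c′ j ≡ b ν - T ν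
          size-new = trans (trans (∑-cong λ x → trans (ind-recolour-new j<k (colours x) (c x ℕ.≟ k) (A-bit ν x)) (eq (r x) (A ν x))) (refl ⊞ (-1ℤ ⊡ refl))) (eq′ (b ν) (T ν))
            where
            eq : ∀ r a → r * (1ℤ - a) ≡ (1ℤ - a) + -1ℤ * ((1ℤ - a) * (1ℤ - r))
            eq = solve-∀
            eq′ : ∀ b t → b + -1ℤ * t ≡ b - t
            eq′ = solve-∀

          size-rest : size c′ k ≡ size c k - size c′ j
          size-rest = trans (trans (∑-cong λ x → trans (ind-recolour-rest j<k (c x ℕ.≟ k) (A-bit ν x)) (trans (eq (r x) (A ν x))
              (cong (λ z → r x + -1ℤ * z) (sym (ind-recolour-new j<k (colours x) (c x ℕ.≟ k) (A-bit ν x)))))) (refl ⊞ (-1ℤ ⊡ refl)))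
              (eq′ (size c k) (size c′ j))
            where
            eq : ∀ r a → r * a ≡ r + -1ℤ * (r * (1ℤ - a))
            eq = solve-∀
            eq′ : ∀ b t → b + -1ℤ * t ≡ b - t
            eq′ = solve-∀

          size-old : ∀ {i} → i ℕ.< j → size c′ i ≡ size c i
          size-old i<j = ∑-cong λ x → ind-recolour-old j<k i<j (c x ℕ.≟ k) (A-bit ν x)

          size-lower : + 2 * (W * (N - κ * size c′ j)) ≤ N
          size-lower = class-bound {κ} {W} {N} {cost ν} {N - κ * size c′ j} {+ ∣ g κ ν ∣} {T ν} {Y₁ ν + + 2 * Y₂ ν}
            1≤κ 0≤W 1≤N 0≤+ (0≤Y₁ ν ⊹ 0≤+ {2} ⊛ 0≤Y₂ ν) refl
            (subst (λ s → N - κ * s ≤ + ∣ g κ ν ∣ + κ * T ν) (sym size-new) (certify (eq N κ (b ν) (T ν) (+ ∣ g κ ν ∣)) (gap (-i≤∣i∣ (g κ ν)))))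
            cost-small
            where
            eq : ∀ N κ b t γ → γ + κ * t - (N - κ * (b - t)) ≡ γ - - (κ * b - N)
            eq = solve-∀

          size-upper : + 2 * (W * (κ * size c′ j - N)) ≤ N
          size-upper = class-bound {κ} {W} {N} {cost ν} {κ * size c′ j - N} {+ ∣ g κ ν ∣} {T ν} {Y₁ ν + + 2 * Y₂ ν}
            1≤κ 0≤W 1≤N 0≤+ (0≤Y₁ ν ⊹ 0≤+ {2} ⊛ 0≤Y₂ ν) refl
            (subst (λ s → κ * s - N ≤ + ∣ g κ ν ∣ + κ * T ν) (sym size-new)
              (certify (eq N κ (b ν) (T ν) (+ ∣ g κ ν ∣)) (gap (i≤∣i∣ (g κ ν)) ⊹ 0≤+ {2} ⊛ (0≤+ {k} ⊛ 0≤T ν))))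
            cost-small
            where
            eq : ∀ N κ b t γ → γ + κ * t - (κ * (b - t) - N) ≡ γ - (κ * b - N) + + 2 * (κ * t)
            eq = solve-∀

          new-classes : ∀ i → i ℕ.< suc j → W * (N - κ * size c′ i) ≤ N
          new-classes i i<1+j with ℕ.m≤n⇒m<n∨m≡n (ℕ.≤-pred i<1+j)
          ... | inj₂ refl = weaken-factor {+ 2} (+≤+ (ℕ.s≤s ℕ.z≤n)) 0≤N size-lower
          ... | inj₁ i<j = weaken-factor {+ 20 * (κ * κ)} (≤-trans (+≤+ (ℕ.s≤s ℕ.z≤n)) (2≤20κ² 1≤κ)) 0≤N
                (≤-trans (≤-reflexive (trans (cong (λ s → + 20 * (κ * κ) * (W * (N - κ * s))) (size-old i<j))
                   (sym (*-assoc (+ 20 * (κ * κ)) W (N - κ * size c i))))) (classes i i<j))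

          -- The rest falls short by its old shortage plus the excess of the new class; each takes
          -- half of the allowance. This is what the upper bound on the new class is for.
          new-rest : W * ((κ - + suc j) * N - κ * size c′ k) ≤ N
          new-rest = ≤-trans (≤-reflexive (trans (cong (λ s → W * ((κ - + suc j) * N - κ * s)) size-rest)
              (cong (W *_) (eq κ (+ j) N (size c k) (size c′ j)))))
            (average-halves {W} {(κ - + j) * N - κ * size c k} {κ * size c′ j - N}
              (half-weight {κ} {W} {(κ - + j) * N - κ * size c k} 1≤κ 0≤N rest) size-upper)
            where
            eq : ∀ κ j N s t → (κ - (1ℤ + j)) * N - κ * (s - t) ≡ ((κ - j) * N - κ * s) + (κ * t - N)
            eq = solve-∀

        recoloured : Clustered (suc j) W c′
        recoloured = record
          { colours   = λ x → recolour-colours j<k (colours x) (c x ℕ.≟ k) (A-bit ν x)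
          ; err-small = err-bound {κ} {W} {N} {cost ν} {Err c} {Err c′} 1≤κ 0≤W 0≤N (0≤cost ν) Err′≤ err-small cost-small
          ; classes   = new-classes
          ; rest      = new-rest
          }

      clustered : ∃ (Clustered (suc j) W)
      clustered = _ , Recolour.recoloured (proj₁ chosen) (proj₂ (proj₂ chosen))

    initially : ∀ {W} → Clustered 0 W (λ _ → k)
    initially {W} = record
      { colours   = λ _ → inj₂ refl
      ; err-small = ≤-trans (≤-reflexive (trans (cong (W *_) Err≡0) (*-zeroʳ W))) (0≤sq N)
      ; classes   = λ _ ()
      ; rest      = ≤-trans (≤-reflexive (trans (cong (λ s → W * ((κ - 0ℤ) * N - κ * s)) size≡N) (eq W κ N))) 0≤+
      }
      where
      Err≡0 : Err (λ _ → k) ≡ 0ℤ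
      Err≡0 = trans (∑-cong λ x → trans (∑-cong λ z → disagree-rest k (A x z)) (trans (∑-const n 0ℤ) (*-zeroʳ N))) (trans (∑-const n 0ℤ) (*-zeroʳ N))
      size≡N : size {n} (λ _ → k) k ≡ N
      size≡N = trans (∑-cong λ x → ind-yes (k ℕ.≟ k) refl) (trans (∑-const n 1ℤ) (*-identityʳ N))
      eq : ∀ W κ N → W * ((κ - 0ℤ) * N - κ * N) ≡ 0ℤ
      eq = solve-∀

    -- The induction fixes the final accuracy and works backwards: j + 1 clusters with error 1/W
    -- come from j clusters with error 1/(20κ²W). `weight` accumulates in the same order, so the
    -- hypotheses pass to the recursive call unchanged.
    cluster : ∀ j → j ℕ.≤ k → ∀ {W} → 1ℤ ≤ W → weight κ j W * Γ κ ≤ N * N → weight κ j W * Y ≤ N * N * N → ∃ (Clustered j W)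
    cluster zero _ _ _ _ = _ , initially
    cluster (suc j) j<k {W} 1≤W Γ-small Y-small =
      Step.clustered j<k 1≤W
            (≤-trans (*-monoʳ 0≤Γ W′≤) Γ-small) (≤-trans (*-monoʳ 0≤Y W′≤) Y-small)
            (proj₂ (cluster j (ℕ.<⇒≤ j<k) 1≤W′ Γ-small Y-small))
      where
      1≤W′ : 1ℤ ≤ + 20 * (κ * κ) * W
      1≤W′ = 1≤-* (1≤-* {+ 20} (+≤+ (ℕ.s≤s ℕ.z≤n)) (1≤-* (+≤+ 1≤k) (+≤+ 1≤k))) 1≤W
      W′≤ = W≤weight j (+≤+ 1≤k) 1≤W′
      *-monoʳ : ∀ {a b c} → 0ℤ ≤ c → a ≤ b → a * c ≤ b * c
      *-monoʳ 0≤c p = *-mono′ 0≤c p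
        where
        eq : ∀ a b c → b * c - a * c ≡ (b - a) * c
        eq = solve-∀
        *-mono′ : ∀ {a b c} → 0ℤ ≤ c → a ≤ b → a * c ≤ b * c
        *-mono′ {a} {b} {c} 0≤c p = certify (eq a b c) (gap p ⊛ 0≤c)
      0≤Γ : 0ℤ ≤ Γ κ
      0≤Γ = ∑-nonneg λ x → 0≤+ {∣ g κ x ∣}
      0≤Y : 0ℤ ≤ Y
      0≤Y = ∑-nonneg λ a → ∑-nonneg λ e → 0≤A a e ⊛ 0≤P a e

  ind-cong : ∀ {p q} {P : Set p} {Q : Set q} (P? : Dec P) (Q? : Dec Q) → (P → Q) → (Q → P) → ind P? ≡ ind Q?
  ind-cong (yes p) Q? f g = sym (ind-yes Q? (f p))
  ind-cong (no ¬p) Q? f g = sym (ind-no Q? λ q → ¬p (g q))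

  ∑-zero-const : ∀ n → ∑[ i ] 0ℤ ≡ 0ℤ
  ∑-zero-const n = trans (∑-const n 0ℤ) (*-zeroʳ (+ n))

  ∑-pick : ∀ {n} (x : Fin n) (f : Fin n → ℤ) → ∑[ z ] (ind (x Fin.≟ z) * f z) ≡ f x
  ∑-pick {suc n} zero f = trans (∑-suc _) (trans (cong₂ _+_ (*-identityˡ (f zero)) (∑-zero-const n)) (+-identityʳ (f zero)))
  ∑-pick {suc n} (suc x) f = trans (∑-suc _) (trans (+-identityˡ _) (trans
    (∑-cong λ z → cong (_* f (suc z)) (ind-cong (suc x Fin.≟ suc z) (x Fin.≟ z) Fin.suc-injective (cong suc)))
    (∑-pick x (λ z → f (suc z)))))

  ∑-ind : ∀ {n} (x : Fin n) → ∑[ z ] ind (x Fin.≟ z) ≡ 1ℤ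
  ∑-ind x = trans (∑-cong λ z → sym (*-identityʳ (ind (x Fin.≟ z)))) (∑-pick x (λ _ → 1ℤ))

  term≤∑ : ∀ {n} {f : Fin n → ℤ} → (∀ i → 0ℤ ≤ f i) → ∀ x → f x ≤ ∑ f
  term≤∑ {f = f} 0≤f x = ≤-trans (≤-reflexive (sym (∑-pick x f)))
    (∑-mono λ z → ≤-trans (certify (eq (ind (x Fin.≟ z)) (f z)) (Bit-0≤ (Bit-not (ind-bit (x Fin.≟ z))) ⊛ 0≤f z)) (≤-reflexive (*-identityˡ (f z))))
    where
    eq : ∀ i f → 1ℤ * f - i * f ≡ (1ℤ - i) * f
    eq = solve-∀

  ∑-toℕ≤1 : ∀ {n} m → ∑ {n} (λ t → ind (toℕ t ℕ.≟ m)) ≤ 1ℤ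
  ∑-toℕ≤1 {n} m with m ℕ.<? n
  ... | yes m<n = ≤-reflexive (trans (∑-cong λ t → ind-cong (toℕ t ℕ.≟ m) (fromℕ< m<n Fin.≟ t)
                    (λ { refl → Fin.fromℕ<-toℕ t m<n }) λ { refl → toℕ-fromℕ< m<n }) (∑-ind (fromℕ< m<n)))
  ... | no m≮n = ≤-trans (≤-reflexive (trans (∑-cong λ t → ind-no (toℕ t ℕ.≟ m) λ { refl → m≮n (toℕ<n t) }) (∑-zero-const n))) 0≤+

  -- Matching the clusters with the parts of the Turán graph

  module _ (n k : ℕ) .{{_ : NonZero k}} where

    part : Fin n → ℕ
    part t = toℕ t % k

    -- A member t of the i-th residue class is determined by t / k ≤ n / k.
    part-size≤ : ∀ i → + k * ∑[ t ] ind (part t ℕ.≟ i) ≤ + n + + k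
    part-size≤ i = begin
      + k * ∑[ t ] ind (part t ℕ.≟ i)                                       ≤⟨ *-monoˡ (0≤+ {k}) (∑-mono quotient) ⟩
      + k * ∑[ t ] ∑ {suc (n / k)} (λ q → ind (toℕ t ℕ.≟ i ℕ.+ toℕ q ℕ.* k)) ≡⟨ cong (+ k *_) (∑-comm _) ⟩
      + k * ∑ {suc (n / k)} (λ q → ∑[ t ] ind (toℕ t ℕ.≟ i ℕ.+ toℕ q ℕ.* k)) ≤⟨ *-monoˡ (0≤+ {k}) (∑-bound λ q → ∑-toℕ≤1 (i ℕ.+ toℕ q ℕ.* k)) ⟩
      + k * (+ suc (n / k) * 1ℤ)                                            ≡⟨ cong (+ k *_) (*-identityʳ (+ suc (n / k))) ⟩
      + k * + suc (n / k)                                                   ≡⟨ sym (pos-* k (suc (n / k))) ⟩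
      + (k ℕ.* suc (n / k))                                                 ≤⟨ +≤+ (ℕ.≤-trans (ℕ.≤-reflexive (ℕ.*-suc k (n / k)))
                                                                                (ℕ.≤-trans (ℕ.+-monoʳ-≤ k (ℕ.≤-trans (ℕ.≤-reflexive (ℕ.*-comm k (n / k))) (m/n*n≤m n k)))
                                                                                  (ℕ.≤-reflexive (ℕ.+-comm k n)))) ⟩
      + n + + k                                                             ∎
      where
      open ≤-Reasoning
      quotient : ∀ t → ind (part t ℕ.≟ i) ≤ ∑ {suc (n / k)} (λ q → ind (toℕ t ℕ.≟ i ℕ.+ toℕ q ℕ.* k))
      quotient t with part t ℕ.≟ i
      ... | no _ = ∑-nonneg λ q → Bit-0≤ (ind-bit (toℕ t ℕ.≟ i ℕ.+ toℕ q ℕ.* k))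
      ... | yes refl = ≤-trans (≤-reflexive (sym (ind-yes (toℕ t ℕ.≟ part t ℕ.+ toℕ q ℕ.* k)
              (trans (m≡m%n+[m/n]*n (toℕ t) k) (cong (λ z → part t ℕ.+ z ℕ.* k) (sym (toℕ-fromℕ< q<)))))))
            (term≤∑ (λ q → Bit-0≤ (ind-bit (toℕ t ℕ.≟ part t ℕ.+ toℕ q ℕ.* k))) q)
        where
        q< : toℕ t / k ℕ.< suc (n / k)
        q< = ℕ.s≤s (/-monoˡ-≤ k (ℕ.<⇒≤ (toℕ<n t)))
        q : Fin (suc (n / k))
        q = fromℕ< q<

    module Balance (c : Fin n → ℕ) where

      wrong : Permutation n n → Fin n → ℤ
      wrong σ x = 1ℤ - ind (c x ℕ.≟ part (σ ⟨$⟩ʳ x))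

      0≤wrong : ∀ σ x → 0ℤ ≤ wrong σ x
      0≤wrong σ x = Bit-0≤ (Bit-not (ind-bit (c x ℕ.≟ part (σ ⟨$⟩ʳ x))))

      Optimal : Permutation n n → Set
      Optimal σ = ∀ i → (∀ x → c x ≡ i → part (σ ⟨$⟩ʳ x) ≡ i) ⊎ (∀ x → part (σ ⟨$⟩ʳ x) ≡ i → c x ≡ i)

      Swappable : Permutation n n → Fin n → Fin n → Set
      Swappable σ x w = c x ≢ part (σ ⟨$⟩ʳ x) × part (σ ⟨$⟩ʳ w) ≡ c x × c w ≢ c x

      -- The swap sends x to a place in the part of its own colour. It cannot harm w, whose colour
      -- already differed from that part.
      swap-improves : ∀ σ x w → Swappable σ x w → ∑ (wrong (transpose x w ∘ₚ σ)) + 1ℤ ≤ ∑ (wrong σ)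
      swap-improves σ x w (x-wrong , w∈ , w-wrong) =
        ≤-trans (≤-reflexive (sym (refl ⊞ ∑-ind x))) (∑-mono pointwise)
        where
        pointwise : ∀ z → wrong (transpose x w ∘ₚ σ) z + ind (x Fin.≟ z) ≤ wrong σ z
        pointwise z with z Fin.≟ x
        ... | yes refl rewrite ind-yes (c z ℕ.≟ part (σ ⟨$⟩ʳ w)) (sym w∈)
                | ind-no (c z ℕ.≟ part (σ ⟨$⟩ʳ z)) x-wrong | ind-yes (z Fin.≟ z) refl = ≤-refl
        ... | no z≢x rewrite ind-no (x Fin.≟ z) (≢-sym z≢x) with z Fin.≟ w
        ...   | yes refl rewrite ind-no (c z ℕ.≟ part (σ ⟨$⟩ʳ z)) (λ e → w-wrong (trans e w∈)) =
                ≤-trans (≤-reflexive (+-identityʳ _)) (Bit-≤1 (Bit-not (ind-bit (c z ℕ.≟ part (σ ⟨$⟩ʳ x)))))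
        ...   | no z≢w = ≤-reflexive (+-identityʳ _)

      swappable? : ∀ σ → Dec (∃ λ x → ∃ λ w → Swappable σ x w)
      swappable? σ = any? λ x → any? λ w → ¬? (c x ℕ.≟ part (σ ⟨$⟩ʳ x)) ×-dec part (σ ⟨$⟩ʳ w) ℕ.≟ c x ×-dec ¬? (c w ℕ.≟ c x)

      unswappable⇒optimal : ∀ σ → ¬ (∃ λ x → ∃ λ w → Swappable σ x w) → Optimal σ
      unswappable⇒optimal σ none i with any? (λ x → c x ℕ.≟ i ×-dec ¬? (part (σ ⟨$⟩ʳ x) ℕ.≟ i))
      ... | no ok = inj₁ λ x cx≡i → decidable-stable (part (σ ⟨$⟩ʳ x) ℕ.≟ i) λ p≢i → ok (x , cx≡i , p≢i)
      ... | yes (x , refl , p≢i) = inj₂ λ w p≡i → decidable-stable (c w ℕ.≟ i) λ cw≢i →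
              none (x , w , ≢-sym p≢i , p≡i , cw≢i)

      -- Each swap lowers the number of misplaced vertices, which bounds the recursion.
      improve : ∀ fuel σ → ∑ (wrong σ) ≤ + fuel → ∃ Optimal
      improve fuel σ bound with swappable? σ
      ... | no none = σ , unswappable⇒optimal σ none
      improve zero σ bound | yes (x , w , s) = contradiction
        (≤-trans (+-monoˡ-≤ 1ℤ (∑-nonneg (0≤wrong (transpose x w ∘ₚ σ)))) (≤-trans (swap-improves σ x w s) bound)) λ { (+≤+ ()) }
      improve (suc fuel) σ bound | yes (x , w , s) = improve fuel (transpose x w ∘ₚ σ)
        (≤-trans (≤-trans (≤-reflexive (eq (∑ (wrong (transpose x w ∘ₚ σ))))) (+-monoˡ-≤ -1ℤ (≤-trans (swap-improves σ x w s) bound))) ≤-refl)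
        where
        eq : ∀ a → a ≡ a + 1ℤ + -1ℤ
        eq = solve-∀

      optimum : ∃ Optimal
      optimum = improve ∣ ∑ (wrong Perm.id) ∣ Perm.id (i≤∣i∣ (∑ (wrong Perm.id)))

      module _ {σ : Permutation n n} (opt : Optimal σ) {W : ℤ} (0≤W : 0ℤ ≤ W)
        (classes : ∀ i → i ℕ.< k → W * (+ n - + k * size c i) ≤ + n) where

        private
          in-part : ℕ → Fin n → ℤ
          in-part i x = ind (part (σ ⟨$⟩ʳ x) ℕ.≟ i)

          unmatched : ℕ → ℤ
          unmatched i = ∑[ x ] (in-part i x * (1ℤ - ind (c x ℕ.≟ i)))

          -- Misplaced vertices are sorted by the part of their image rather than by colour: images
          -- lie in one of k parts, while colours include the rest colour k.
          ∑wrong : ∑ (wrong σ) ≡ ∑ {k} (λ i → unmatched (toℕ i))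
          ∑wrong = trans (∑-cong λ x → sym (trans (∑-cong λ i → cong (_* (1ℤ - ind (c x ℕ.≟ toℕ i)))
                      (ind-cong (part (σ ⟨$⟩ʳ x) ℕ.≟ toℕ i) (p x Fin.≟ i)
                        (λ e → toℕ-injective (trans (toℕ-fromℕ< (p< x)) e)) (λ e → trans (sym (toℕ-fromℕ< (p< x))) (cong toℕ e))))
                      (trans (∑-pick (p x) _) (cong (λ i → 1ℤ - ind (c x ℕ.≟ i)) (toℕ-fromℕ< (p< x))))))
                    (∑-comm _)
            where
            p< : ∀ x → part (σ ⟨$⟩ʳ x) ℕ.< k
            p< x = m%n<n (toℕ (σ ⟨$⟩ʳ x)) k
            p : Fin n → Fin k
            p x = fromℕ< (p< x)

          -- If the class maps into the part, the foreign vertices of the part number its size minus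
          -- that of the class, at most 1 + n/(kW); otherwise there are none. So the clustering has
          -- to maintain only lower bounds on its classes.
          unmatched≤ : ∀ i → i ℕ.< k → + k * (W * unmatched i) ≤ + k * W + + n
          unmatched≤ i i<k with opt i
          ... | inj₂ part⇒class = ≤-trans (≤-reflexive (trans (cong (λ u → + k * (W * u)) unmatched≡0)
                  (trans (cong (+ k *_) (*-zeroʳ W)) (*-zeroʳ (+ k))))) (0≤+ {k} ⊛ 0≤W ⊹ 0≤+ {n})
            where
            unmatched≡0 : unmatched i ≡ 0ℤ
            unmatched≡0 = trans (∑-cong pointwise) (∑-zero-const n)
              where
              pointwise : ∀ x → in-part i x * (1ℤ - ind (c x ℕ.≟ i)) ≡ 0ℤ
              pointwise x with part (σ ⟨$⟩ʳ x) ℕ.≟ i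
              ... | no _ = refl
              ... | yes e rewrite ind-yes (c x ℕ.≟ i) (part⇒class x e) = refl
          ... | inj₁ class⇒part = subst (λ u → + k * (W * u) ≤ + k * W + + n) (sym unmatched≡)
                  (certify (eq (+ k) W (+ n) τ (size c i)) (0≤W ⊛ gap (part-size≤ i) ⊹ gap (classes i i<k)))
            where
            τ = ∑[ t ] ind (part t ℕ.≟ i)
            eq : ∀ k W n τ s → k * W + n - k * (W * (τ - s)) ≡ W * (n + k - k * τ) + (n - W * (n - k * s))
            eq = solve-∀
            unmatched≡ : unmatched i ≡ τ - size c i
            unmatched≡ = trans (trans (∑-cong pointwise) (sym (∑-permute (λ t → ind (part t ℕ.≟ i)) σ) ⊞ (-1ℤ ⊡ refl))) (eq′ τ (size c i))
              where
              eq′ : ∀ a b → a + -1ℤ * b ≡ a - b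
              eq′ = solve-∀
              pointwise : ∀ x → in-part i x * (1ℤ - ind (c x ℕ.≟ i)) ≡ in-part i x + -1ℤ * ind (c x ℕ.≟ i)
              pointwise x with c x ℕ.≟ i
              ... | no _ = trans (*-identityʳ (in-part i x)) (sym (+-identityʳ (in-part i x)))
              ... | yes e rewrite ind-yes (part (σ ⟨$⟩ʳ x) ℕ.≟ i) (class⇒part x e) = refl

        wrong-small : 1ℤ ≤ + k → W * ∑ (wrong σ) ≤ + k * W + + n
        wrong-small 1≤k = *-cancelˡ 1≤k (begin
          + k * (W * ∑ (wrong σ))                       ≡⟨ cong (λ s → + k * (W * s)) ∑wrong ⟩
          + k * (W * ∑ {k} (λ i → unmatched (toℕ i)))   ≡⟨ cong (+ k *_) (*-distribˡ-∑ W _) ⟩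
          + k * ∑ {k} (λ i → W * unmatched (toℕ i))     ≡⟨ *-distribˡ-∑ (+ k) _ ⟩
          ∑ {k} (λ i → + k * (W * unmatched (toℕ i)))   ≤⟨ ∑-bound (λ i → unmatched≤ (toℕ i) (toℕ<n i)) ⟩
          + k * (+ k * W + + n)                         ∎)
          where open ≤-Reasoning

  -- Counts in graphs as sums

  module _ {X : Set} {P : X → Set} (P? : Decidable P) where

    count : List X → ℤ
    count xs = + length (filter P? xs)

    count-∷ : ∀ x xs → count (x ∷ xs) ≡ ind (P? x) + count xs
    count-∷ x xs with P? x
    ... | yes _ = refl
    ... | no _ = sym (+-identityˡ _)

    count-concatMap : ∀ {Y : Set} {m} (f : Y → List X) (h : Fin m → Y) →
      count (concatMap f (tabulate h)) ≡ ∑[ i ] count (f (h i))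
    count-concatMap {m = zero} f h = sym (∑-zero _)
    count-concatMap {m = suc m} f h = begin
      count (f (h zero) ++ rest)           ≡⟨ cong (λ l → + length l) (filter-++ P? (f (h zero)) rest) ⟩
      + length (filter P? (f (h zero)) ++ filter P? rest) ≡⟨ cong +_ (length-++ (filter P? (f (h zero)))) ⟩
      count (f (h zero)) + count rest      ≡⟨ cong (λ z → count (f (h zero)) + z) (count-concatMap f (h ∘ suc)) ⟩
      count (f (h zero)) + ∑[ i ] count (f (h (suc i))) ≡⟨ ∑-suc _ ⟨
      ∑[ i ] count (f (h i))               ∎
      where
      open ≡-Reasoning
      rest = concatMap f (tabulate (h ∘ suc))

    count-map : ∀ {Y : Set} {m} (f : Y → X) (h : Fin m → Y) →
      count (map f (tabulate h)) ≡ ∑[ i ] ind (P? (f (h i)))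
    count-map {m = zero} f h = sym (∑-zero _)
    count-map {m = suc m} f h = trans (count-∷ (f (h zero)) _)
      (trans (cong (λ z → ind (P? (f (h zero))) + z) (count-map f (h ∘ suc))) (sym (∑-suc _)))

    count-map-filter : ∀ {Y : Set} {Q : Y → Set} (Q? : Decidable Q) {m} (f : Y → X) (h : Fin m → Y) →
      count (map f (filter Q? (tabulate h))) ≡ ∑[ i ] (ind (Q? (h i)) * ind (P? (f (h i))))
    count-map-filter Q? {zero} f h = sym (∑-zero _)
    count-map-filter Q? {suc m} f h with Q? (h zero) | count-map-filter Q? f (h ∘ suc)
                                       | ∑-suc (λ i → ind (Q? (h i)) * ind (P? (f (h i))))
    ... | yes _ | ih | split = trans (count-∷ (f (h zero)) _)
          (trans (cong₂ _+_ (sym (*-identityˡ (ind (P? (f (h zero)))))) ih) (sym split))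
    ... | no _  | ih | split = trans ih (trans (sym (+-identityˡ _)) (sym split))

  ∧-bits : ∀ D p q r s t → (p ≡ true → q ≡ true → r ≡ true → s ≡ true → t ≡ true → D ≡ true) →
    ind (p Bool.≟ true) * ind (q Bool.≟ true) * (ind (r Bool.≟ true) * ind (s Bool.≟ true) * ind (t Bool.≟ true))
      ≤ ind ((D ∧ p ∧ q ∧ r ∧ s ∧ t) Bool.≟ true)
  ∧-bits D false _ _ _ _ _ = Bit-0≤ (ind-bit ((D ∧ false) Bool.≟ true))
  ∧-bits D true false _ _ _ _ = Bit-0≤ (ind-bit ((D ∧ false) Bool.≟ true))
  ∧-bits D true true false _ _ _ = Bit-0≤ (ind-bit ((D ∧ false) Bool.≟ true))
  ∧-bits D true true true false _ _ = Bit-0≤ (ind-bit ((D ∧ false) Bool.≟ true))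
  ∧-bits D true true true true false _ = Bit-0≤ (ind-bit ((D ∧ false) Bool.≟ true))
  ∧-bits D true true true true true h rewrite h refl refl refl refl refl = ≤-refl

  turan-disagree : ∀ {k a b} z → a ≢ k → ind (z Bool.≟ not (not (does (a ℕ.≟ b)))) ≡ disagree k a b (ind (z Bool.≟ true))
  turan-disagree {k} {a} {b} z a≢k with a ℕ.≟ b
  ... | yes refl = trans (cong (λ e → ind (z Bool.≟ not (not e))) (dec-true (a ℕ.≟ a) refl)) (sym (disagree-same _ a≢k))
  ... | no a≢b = trans (cong (λ e → ind (z Bool.≟ not (not e))) (dec-false (a ℕ.≟ b) a≢b)) (trans (flip z) (sym (disagree-diff _ a≢b)))
    where
    flip : ∀ z → ind (z Bool.≟ false) ≡ 1ℤ - ind (z Bool.≟ true)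
    flip true = refl
    flip false = refl

  module _ {n : ℕ} (G : Graph n) where

    adjacency : Fin n → Fin n → ℤ
    adjacency x y = ind (adj G x y Bool.≟ true)

    adjacency-sym : ∀ x y → adjacency x y ≡ adjacency y x
    adjacency-sym x y = cong (λ b → ind (b Bool.≟ true)) (Graph.sym G x y)

    adjacency-bit : ∀ x y → Bit (adjacency x y)
    adjacency-bit x y = ind-bit (adj G x y Bool.≟ true)

    private
      A = adjacency

    open Kernel A adjacency-sym adjacency-bit

    edges-sum : + edges G ≡ ∑[ i ] ∑[ j ] (ind (i Fin.<? j) * A i j)
    edges-sum = trans (count-concatMap _ _ id) (∑-cong λ i → count-map-filter _ (i Fin.<?_) (λ j → i , j) id)

    2edges≤D : + 2 * + edges G ≤ D
    2edges≤D = begin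
      + 2 * + edges G                                     ≡⟨ trans (cong (+ 2 *_) edges-sum) (double _) ⟩
      ∑[ i ] ∑[ j ] (ind (i Fin.<? j) * A i j) + ∑[ i ] ∑[ j ] (ind (i Fin.<? j) * A i j)
        ≡⟨ cong (λ z → ∑[ i ] ∑[ j ] (ind (i Fin.<? j) * A i j) + z) (trans (∑-comm _) (∑-cong λ j → ∑-cong λ i → cong (ind (i Fin.<? j) *_) (adjacency-sym i j))) ⟩
      ∑[ i ] ∑[ j ] (ind (i Fin.<? j) * A i j) + ∑[ i ] ∑[ j ] (ind (j Fin.<? i) * A i j)
        ≡⟨ sym (trans (∑-cong λ i → refl ⊞ refl) (refl ⊞ refl)) ⟩
      ∑[ i ] ∑[ j ] (ind (i Fin.<? j) * A i j + ind (j Fin.<? i) * A i j) ≤⟨ ∑-mono (λ i → ∑-mono λ j → pair i j) ⟩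
      D                                                   ∎
      where
      open ≤-Reasoning
      double : ∀ a → + 2 * a ≡ a + a
      double = solve-∀
      pair : ∀ i j → ind (i Fin.<? j) * A i j + ind (j Fin.<? i) * A i j ≤ A i j
      pair i j with i Fin.<? j | j Fin.<? i
      ... | yes i<j | yes j<i = contradiction j<i (ℕ.<⇒≯ i<j)
      ... | yes _ | no _ = ≤-reflexive (trans (+-identityʳ _) (*-identityˡ (A i j)))
      ... | no _ | yes _ = ≤-reflexive (trans (+-identityˡ _) (*-identityˡ (A i j)))
      ... | no _ | no _ = Bit-0≤ (adjacency-bit i j)

    labelledC5-sum : + labelledC5 G ≡ ∑[ a ] ∑[ b ] ∑[ c ] ∑[ d ] ∑[ e ] ind (isLabelledC5 G (a , b , c , d , e) Bool.≟ true)
    labelledC5-sum = trans (count-concatMap _ _ id) (∑-cong λ a → trans (count-concatMap _ _ id) (∑-cong λ b →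
      trans (count-concatMap _ _ id) (∑-cong λ c → trans (count-concatMap _ _ id) (∑-cong λ d → count-map _ _ id))))

    C₅-sum : C₅ ≡ ∑[ a ] ∑[ b ] ∑[ c ] ∑[ d ] ∑[ e ] (A a b * A b c * (A c d * A d e * A e a))
    C₅-sum = ∑-cong λ a → sym (trans (∑-comm _) (∑-cong λ c → trans (∑-cong λ b →
        trans (∑-cong λ d → (A a b * A b c) ⊡ refl) ((A a b * A b c) ⊡ refl))
        (trans (∑-*ʳ _ _) (cong (Q a c *_) (trans (∑-comm _) (∑-cong λ e → trans (∑-*ʳ _ _)
          (trans (*-comm (Q c e) (A e a)) (cong (_* Q c e) (adjacency-sym e a)))))))))

    private
      peel : ∀ {P : Set} (P? : Dec P) {x y} → x ≤ 1ℤ → 0ℤ ≤ y → (¬ P → x ≤ y) → x ≤ ind P? + y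
      peel (yes _) {x} x≤1 0≤y _ = ≤-trans (≤-reflexive (sym (+-identityʳ x))) (+-mono-≤ x≤1 0≤y)
      peel (no ¬p) _ _ f = ≤-trans (f ¬p) (≤-reflexive (sym (+-identityˡ _)))

      -- Consecutive vertices of a closed walk differ by irreflexivity, so a walk that is not a
      -- labelled 5-cycle identifies one of the five remaining pairs. Each identification admits N⁴
      -- tuples.
      pentagon : ∀ a b c d e → A a b * A b c * (A c d * A d e * A e a)
        ≤ ind (a Fin.≟ c) + (ind (a Fin.≟ d) + (ind (b Fin.≟ d) + (ind (b Fin.≟ e) + (ind (c Fin.≟ e)
          + ind (isLabelledC5 G (a , b , c , d , e) Bool.≟ true)))))
      pentagon a b c d e =
        peel (a Fin.≟ c) x≤1 (i (a Fin.≟ d) ⊹ (i (b Fin.≟ d) ⊹ (i (b Fin.≟ e) ⊹ (i (c Fin.≟ e) ⊹ i L?)))) λ a≢c →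
        peel (a Fin.≟ d) x≤1 (i (b Fin.≟ d) ⊹ (i (b Fin.≟ e) ⊹ (i (c Fin.≟ e) ⊹ i L?))) λ a≢d →
        peel (b Fin.≟ d) x≤1 (i (b Fin.≟ e) ⊹ (i (c Fin.≟ e) ⊹ i L?)) λ b≢d →
        peel (b Fin.≟ e) x≤1 (i (c Fin.≟ e) ⊹ i L?) λ b≢e →
        peel (c Fin.≟ e) x≤1 (i L?) λ c≢e → final a≢c a≢d b≢d b≢e c≢e
        where
        x = A a b * A b c * (A c d * A d e * A e a)
        L? = isLabelledC5 G (a , b , c , d , e) Bool.≟ true
        x≤1 : x ≤ 1ℤ
        x≤1 = Bit-≤1 (Bit-* (Bit-* (adjacency-bit a b) (adjacency-bit b c))
                (Bit-* (Bit-* (adjacency-bit c d) (adjacency-bit d e)) (adjacency-bit e a)))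
        i : ∀ {P : Set} (P? : Dec P) → 0ℤ ≤ ind P?
        i P? = Bit-0≤ (ind-bit P?)
        distinct-adj : ∀ {x y} → adj G x y ≡ true → x ≢ y
        distinct-adj {x} eq refl with trans (sym eq) (irrefl G x)
        ... | ()
        final : a ≢ c → a ≢ d → b ≢ d → b ≢ e → c ≢ e → x ≤ ind L?
        final a≢c a≢d b≢d b≢e c≢e = ∧-bits distinct (adj G a b) (adj G b c) (adj G c d) (adj G d e) (adj G e a) distinct-true
          where
          -- The test inside `isLabelledC5` written out, since the function there is private and the
          -- rewrites act on the single comparisons.
          distinct : Bool
          distinct = not (does (a Fin.≟ b) ∨ does (a Fin.≟ c) ∨ does (a Fin.≟ d) ∨ does (a Fin.≟ e) ∨ false)
            ∧ not (does (b Fin.≟ c) ∨ does (b Fin.≟ d) ∨ does (b Fin.≟ e) ∨ false)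
            ∧ not (does (c Fin.≟ d) ∨ does (c Fin.≟ e) ∨ false) ∧ not (does (d Fin.≟ e) ∨ false) ∧ true
          distinct-true : adj G a b ≡ true → adj G b c ≡ true → adj G c d ≡ true → adj G d e ≡ true → adj G e a ≡ true → distinct ≡ true
          distinct-true ab bc cd de ea
            rewrite dec-false (a Fin.≟ b) (distinct-adj ab) | dec-false (a Fin.≟ c) a≢c | dec-false (a Fin.≟ d) a≢d
                  | dec-false (a Fin.≟ e) (≢-sym (distinct-adj ea)) | dec-false (b Fin.≟ c) (distinct-adj bc)
                  | dec-false (b Fin.≟ d) b≢d | dec-false (b Fin.≟ e) b≢e | dec-false (c Fin.≟ d) (distinct-adj cd)
                  | dec-false (c Fin.≟ e) c≢e | dec-false (d Fin.≟ e) (distinct-adj de) = refl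

    C₅≤labelledC5 : C₅ ≤ + 5 * (N * N * (N * N)) + + labelledC5 G
    C₅≤labelledC5 = begin
      C₅ ≡⟨ C₅-sum ⟩
      ∑[ a ] ∑[ b ] ∑[ c ] ∑[ d ] ∑[ e ] (A a b * A b c * (A c d * A d e * A e a))
        ≤⟨ (∑-mono λ a → ∑-mono λ b → ∑-mono λ c → ∑-mono λ d → ∑-mono λ e → pentagon a b c d e) ⟩
      ∑[ a ] ∑[ b ] ∑[ c ] ∑[ d ] ∑[ e ] (ind (a Fin.≟ c) + (ind (a Fin.≟ d) + (ind (b Fin.≟ d) + (ind (b Fin.≟ e) + (ind (c Fin.≟ e)
          + ind (isLabelledC5 G (a , b , c , d , e) Bool.≟ true))))))
        ≡⟨ trans (∑-cong λ a → trans (∑-cong λ b → trans (∑-cong λ c → trans (∑-cong λ d →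
             const ⊞ (const ⊞ (const ⊞ (∑-ind b ⊞ (∑-ind c ⊞ refl)))))
             (const ⊞ ((N ⊡ ∑-ind a) ⊞ ((N ⊡ ∑-ind b) ⊞ (const ⊞ (const ⊞ refl))))))
             ((N ⊡ (N ⊡ ∑-ind a)) ⊞ (const ⊞ (const ⊞ (const ⊞ (const ⊞ refl))))))
             (const ⊞ (const ⊞ (const ⊞ (const ⊞ (const ⊞ refl))))))
             (const ⊞ (const ⊞ (const ⊞ (const ⊞ (const ⊞ sym labelledC5-sum))))) ⟩
      N * (N * (N * (N * 1ℤ))) + (N * (N * (N * (N * 1ℤ))) + (N * (N * (N * (N * 1ℤ))) + (N * (N * (N * (N * 1ℤ))) + (N * (N * (N * (N * 1ℤ))) + + labelledC5 G))))
        ≡⟨ eq N (+ labelledC5 G) ⟩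
      + 5 * (N * N * (N * N)) + + labelledC5 G ∎
      where
      open ≤-Reasoning
      const : ∀ {c} → ∑ {n} (λ _ → c) ≡ N * c
      const {c} = ∑-const n c
      eq : ∀ N L → N * (N * (N * (N * 1ℤ))) + (N * (N * (N * (N * 1ℤ))) + (N * (N * (N * (N * 1ℤ))) + (N * (N * (N * (N * 1ℤ))) + (N * (N * (N * (N * 1ℤ))) + L))))
        ≡ + 5 * (N * N * (N * N)) + L
      eq = solve-∀

    module _ (m : ℕ) (c : Fin n → ℕ) (σ : Permutation n n) where
      private
        k = suc m
      open Balance n k c

      -- When both images lie in the parts named by the colours, a mismatch is exactly a `disagree`;
      -- otherwise `wrong` pays for the pair. Parts are below k, so every vertex of the rest is
      -- wrong, which covers the uncharged pairs there.
      mismatch≤ : + mismatch G (turanAdj k n) (σ ⟨$⟩ʳ_) ≤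
        ∑[ x ] ∑[ y ] disagree k (c x) (c y) (A x y) + + 2 * (N * ∑ (wrong σ))
      mismatch≤ = begin
        + mismatch G (turanAdj k n) (σ ⟨$⟩ʳ_)
          ≡⟨ trans (count-concatMap _ _ id) (∑-cong λ x → count-map-filter _ (x Fin.<?_) (λ y → x , y) id) ⟩
        ∑[ x ] ∑[ y ] (ind (x Fin.<? y) * ind (adj G x y Bool.≟ not (turanAdj k n (σ ⟨$⟩ʳ x) (σ ⟨$⟩ʳ y))))
          ≤⟨ ∑-mono (λ x → ∑-mono λ y → pair x y) ⟩
        ∑[ x ] ∑[ y ] (disagree k (c x) (c y) (A x y) + (wrong σ x + wrong σ y))
          ≡⟨ trans (∑-cong λ x → refl ⊞ (∑-const n (wrong σ x) ⊞ refl)) (refl ⊞ ((N ⊡ refl) ⊞ ∑-const n (∑ (wrong σ)))) ⟩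
        ∑[ x ] ∑[ y ] disagree k (c x) (c y) (A x y) + (N * ∑ (wrong σ) + N * ∑ (wrong σ))
          ≡⟨ cong (λ z → ∑[ x ] ∑[ y ] disagree k (c x) (c y) (A x y) + z) (eq (N * ∑ (wrong σ))) ⟩
        ∑[ x ] ∑[ y ] disagree k (c x) (c y) (A x y) + + 2 * (N * ∑ (wrong σ)) ∎
        where
        open ≤-Reasoning
        eq : ∀ a → a + a ≡ + 2 * a
        eq = solve-∀
        p : Fin n → ℕ
        p x = part n k (σ ⟨$⟩ʳ x)
        p≢k : ∀ x → p x ≢ k
        p≢k x = ℕ.<⇒≢ (m%n<n (toℕ (σ ⟨$⟩ʳ x)) k)
        agreeing : ∀ x y → c x ≡ p x → c y ≡ p y → ind (adj G x y Bool.≟ not (not (does (p x ℕ.≟ p y)))) ≤ disagree k (c x) (c y) (A x y)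
        agreeing x y ex ey rewrite ex | ey = ≤-reflexive (turan-disagree (adj G x y) (p≢k x))
        Hit : Fin n → Fin n → ℤ
        Hit x y = ind (adj G x y Bool.≟ not (turanAdj k n (σ ⟨$⟩ʳ x) (σ ⟨$⟩ʳ y)))
        hit-bit : ∀ x y → Bit (Hit x y)
        hit-bit x y = ind-bit (adj G x y Bool.≟ not (turanAdj k n (σ ⟨$⟩ʳ x) (σ ⟨$⟩ʳ y)))
        hit : ∀ x y → Hit x y ≤ disagree k (c x) (c y) (A x y) + (wrong σ x + wrong σ y)
        hit x y with c x ℕ.≟ p x | c y ℕ.≟ p y
        ... | yes ex | yes ey = ≤-trans (agreeing x y ex ey) (≤-reflexive (sym (+-identityʳ _)))
        ... | no _ | yes _ = ≤-trans (≤-reflexive (sym (+-identityˡ (Hit x y)))) (+-mono-≤ (disagree-nonneg k (c x) (c y) (adjacency-bit x y)) (Bit-≤1 (hit-bit x y)))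
        ... | yes _ | no _ = ≤-trans (≤-reflexive (sym (+-identityˡ (Hit x y)))) (+-mono-≤ (disagree-nonneg k (c x) (c y) (adjacency-bit x y)) (Bit-≤1 (hit-bit x y)))
        ... | no _ | no _ = ≤-trans (≤-reflexive (sym (+-identityˡ (Hit x y)))) (+-mono-≤ (disagree-nonneg k (c x) (c y) (adjacency-bit x y)) (≤-trans (Bit-≤1 (hit-bit x y)) (+≤+ (ℕ.s≤s ℕ.z≤n))))
        pair : ∀ x y → ind (x Fin.<? y) * Hit x y ≤ disagree k (c x) (c y) (A x y) + (wrong σ x + wrong σ y)
        pair x y = ≤-trans (certify (eq′ (ind (x Fin.<? y)) (Hit x y)) (Bit-0≤ (Bit-not (ind-bit (x Fin.<? y))) ⊛ Bit-0≤ (hit-bit x y))) (hit x y)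
          where
          eq′ : ∀ i h → h - i * h ≡ (1ℤ - i) * h
          eq′ = solve-∀

  -- Choice of constants and the integer form of the theorem

  quality : ℤ → ℕ → ℤ → ℤ
  quality κ k q = weight κ k (+ 5 * q)

  -- The first summand provides the accuracy M for the clustering, the second makes N large enough
  -- to absorb the rounding of part sizes, and the third keeps the value positive.
  threshold : ℕ → ℤ → ℤ
  threshold k q = + 386 * (+ k * (+ k * + k * (+ k * + k))) * (quality (+ k) k q * quality (+ k) k q) + + 5 * q * + k + 1ℤ

  1≤threshold : ∀ k {q} → 1ℤ ≤ q → 1ℤ ≤ threshold k q
  1≤threshold k {q} 1≤q = certify (eq (+ 386 * (+ k * (+ k * + k * (+ k * + k))) * (M * M)) (+ 5 * q * + k))
    (0≤+ {386} ⊛ (0≤+ {k} ⊛ (0≤sq (+ k) ⊛ 0≤sq (+ k))) ⊛ 0≤sq M ⊹ 0≤+ {5} ⊛ ≤-trans 0≤+ 1≤q ⊛ 0≤+ {k})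
    where
    M = quality (+ k) k q
    eq : ∀ a b → a + b + 1ℤ - 1ℤ ≡ a + b
    eq = solve-∀

  -- Replacing N(N - 1) by N² loses at most (κ - 1)EN ≤ (κ - 1)N², and ε itself loses κN².
  edges⇒many : ∀ {κ E N D e} → 1ℤ ≤ κ → 0ℤ ≤ E → 0ℤ ≤ N → E ≤ N → + 2 * e ≤ D →
    ((κ - 1ℤ) * E - κ) * (N * (N - 1ℤ)) ≤ + 2 * (κ * E) * e →
    - (+ 2 * (κ * (N * N))) ≤ E * (κ * D - (κ - 1ℤ) * (N * N))
  edges⇒many {κ} {E} {N} {D} {e} 1≤κ 0≤E 0≤N E≤N p q = certify (eq κ E N D e)
    (≤-trans 0≤+ 1≤κ ⊛ 0≤E ⊛ gap p ⊹ gap q ⊹ gap 1≤κ ⊛ 0≤N ⊛ gap E≤N ⊹ 0≤sq N ⊹ ≤-trans 0≤+ 1≤κ ⊛ 0≤N)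
    where
    eq : ∀ κ E N D e → E * (κ * D - (κ - 1ℤ) * (N * N)) - - (+ 2 * (κ * (N * N)))
      ≡ κ * E * (D - + 2 * e) + (+ 2 * (κ * E) * e - ((κ - 1ℤ) * E - κ) * (N * (N - 1ℤ)))
        + (κ - 1ℤ) * N * (N - E) + N * N + κ * N
    eq = solve-∀

  -- 29 is 10 for ε times ten labellings, 9 for the remainder of the division by ten, 5 for the
  -- degenerate walks, and 5 to spare.
  copies⇒few : ∀ {K a E N C L} → 0ℤ ≤ K → 0ℤ ≤ E → 1ℤ ≤ N → E ≤ N → C ≤ + 5 * (N * N * (N * N)) + L →
    K * E * L ≤ (a * E + + 10 * K) * (N * N * (N * N) * N) + + 9 * (K * E) →
    K * (E * C) ≤ a * E * (N * N * (N * N) * N) + + 29 * (K * (N * N * (N * N) * N))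
  copies⇒few {K} {a} {E} {N} {C} {L} 0≤K 0≤E 1≤N E≤N p q = certify (eq K a E N C L)
    (0≤K ⊛ 0≤E ⊛ gap p ⊹ gap q ⊹ 0≤K ⊛ (0≤+ {5} ⊛ (0≤sq N ⊛ 0≤sq N) ⊹ 0≤+ {9}) ⊛ gap E≤N
     ⊹ 0≤+ {9} ⊛ (0≤K ⊛ 0≤N ⊛ gap (1≤-* (1≤-* 1≤N 1≤N) (1≤-* 1≤N 1≤N))) ⊹ 0≤+ {5} ⊛ (0≤K ⊛ (0≤sq N ⊛ 0≤sq N ⊛ 0≤N)))
    where
    0≤N = ≤-trans 0≤+ 1≤N
    eq : ∀ K a E N C L → a * E * (N * N * (N * N) * N) + + 29 * (K * (N * N * (N * N) * N)) - K * (E * C)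
      ≡ K * E * (+ 5 * (N * N * (N * N)) + L - C)
        + ((a * E + + 10 * K) * (N * N * (N * N) * N) + + 9 * (K * E) - K * E * L)
        + K * (+ 5 * (N * N * (N * N)) + + 9) * (N - E)
        + + 9 * (K * N * (N * N * (N * N) - 1ℤ)) + + 5 * (K * (N * N * (N * N) * N))
    eq = solve-∀

  -- In units of N²/(5q), `Err` contributes 1 and the misplaced vertices 2·2: one 2 for the ends of
  -- a pair, the other because rounding at most doubles their bound. This is the 5 in `quality`.
  total-mismatch : ∀ {q κ N mis Err bad} → 0ℤ ≤ q → 0ℤ ≤ N → + 5 * q * κ ≤ N → mis ≤ Err + + 2 * (N * bad) →
    + 5 * q * Err ≤ N * N → + 5 * q * bad ≤ κ * (+ 5 * q) + N → q * mis ≤ N * N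
  total-mismatch {q} {κ} {N} {mis} {Err} {bad} 0≤q 0≤N a b c d = *-cancelˡ {c = + 5} (+≤+ (ℕ.s≤s ℕ.z≤n))
    (certify (eq q κ N mis Err bad) (0≤+ {5} ⊛ 0≤q ⊛ gap b ⊹ gap c ⊹ 0≤+ {2} ⊛ 0≤N ⊛ gap d ⊹ 0≤+ {2} ⊛ 0≤N ⊛ gap a))
    where
    eq : ∀ q κ N mis Err bad → + 5 * (N * N) - + 5 * (q * mis)
      ≡ + 5 * q * (Err + + 2 * (N * bad) - mis) + (N * N - + 5 * q * Err) + + 2 * N * (κ * (+ 5 * q) + N - + 5 * q * bad)
        + + 2 * N * (N - + 5 * q * κ)
    eq = solve-∀

  -- The hypotheses of the theorem with denominators cleared, for ε = 1/E; the conclusion bounds the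
  -- distance by N²/q. The term 9KE allows for the rounding in `copiesC5`.
  turán-stability : ∀ m {n} (G : Graph n) (q : ℤ) → let k = suc m; κ = + k; K = κ * κ * (κ * κ); N = + n in
    + 3 ≤ κ → 1ℤ ≤ q → ∀ {E} → threshold k q ≡ E → E ≤ N →
    ((κ - 1ℤ) * E - κ) * (N * (N - 1ℤ)) ≤ + 2 * (κ * E) * + edges G →
    K * E * + labelledC5 G ≤ (h₀ κ * E + + 10 * K) * (N * N * (N * N) * N) + + 9 * (K * E) →
    Σ (Permutation n n) λ σ → q * + mismatch G (turanAdj k n) (σ ⟨$⟩ʳ_) ≤ N * N
  turán-stability m {n} G q 3≤κ 1≤q {E} E≡ E≤N many few = build (cluster k ℕ.≤-refl 1≤W MΓ MY)
    where
    k = suc m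
    κ = + k
    N = + n
    W = + 5 * q
    M = quality κ k q
    0≤q = ≤-trans 0≤+ 1≤q
    1≤κ : 1ℤ ≤ κ
    1≤κ = +≤+ (ℕ.s≤s ℕ.z≤n)
    1≤W : 1ℤ ≤ W
    1≤W = 1≤-* {+ 5} (+≤+ (ℕ.s≤s ℕ.z≤n)) 1≤q
    0≤κ : 0ℤ ≤ κ
    0≤κ = 0≤+
    0≤main : 0ℤ ≤ + 386 * (κ * (κ * κ * (κ * κ))) * (M * M)
    0≤main = 0≤+ {386} ⊛ (0≤κ ⊛ (0≤sq κ ⊛ 0≤sq κ)) ⊛ 0≤sq M
    0≤Wκ : 0ℤ ≤ W * κ
    0≤Wκ = ≤-trans 0≤+ 1≤W ⊛ 0≤κ
    main≤E : + 386 * (κ * (κ * κ * (κ * κ))) * (M * M) ≤ E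
    main≤E = subst (+ 386 * (κ * (κ * κ * (κ * κ))) * (M * M) ≤_) E≡ (certify (eq (+ 386 * (κ * (κ * κ * (κ * κ))) * (M * M)) (W * κ)) (0≤Wκ ⊹ 0≤+ {1}))
      where
      eq : ∀ a b → a + b + 1ℤ - a ≡ b + 1ℤ
      eq = solve-∀
    Wκ≤N : W * κ ≤ N
    Wκ≤N = ≤-trans (certify (eq (+ 386 * (κ * (κ * κ * (κ * κ))) * (M * M)) (W * κ)) (0≤main ⊹ 0≤+ {1})) (subst (_≤ N) (sym E≡) E≤N)
      where
      eq : ∀ a b → a + b + 1ℤ - b ≡ a + 1ℤ
      eq = solve-∀
    1≤N : 1ℤ ≤ N
    1≤N = ≤-trans (certify (eq (+ 386 * (κ * (κ * κ * (κ * κ))) * (M * M)) (W * κ)) (0≤main ⊹ 0≤Wκ)) (subst (_≤ N) (sym E≡) E≤N)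
      where
      eq : ∀ a b → a + b + 1ℤ - 1ℤ ≡ a + b
      eq = solve-∀
    0≤E : 0ℤ ≤ E
    0≤E = ≤-trans 0≤main main≤E
    A = adjacency G
    open Cherries A (adjacency-sym G) (adjacency-bit G) using (C₅; D; Γ; Y)
    open Small A (adjacency-sym G) (adjacency-bit G) κ E M
    many′ = edges⇒many {κ} {E} {N} {D} {+ edges G} 1≤κ 0≤E 0≤+ E≤N (2edges≤D G) many
    few′ = copies⇒few {κ * κ * (κ * κ)} {h₀ κ} {E} {N} {C₅} {+ labelledC5 G} (0≤sq κ ⊛ 0≤sq κ) 0≤E 1≤N E≤N (C₅≤labelledC5 G) few
    MΓ : M * Γ κ ≤ N * N
    MΓ = MΓ≤N² 1≤N 3≤κ main≤E many′ few′
    MY : M * Y ≤ N * N * N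
    MY = MY≤N³ 1≤N 3≤κ main≤E many′ few′
    open Clusters A (adjacency-sym G) (adjacency-bit G) k (ℕ.s≤s ℕ.z≤n) (drop‿+≤+ 1≤N) using (cluster; Clustered; Err)
    module _ (c : Fin n → ℕ) (C : Clustered k W c) where
      open Clustered C
      open Balance n k c
      conclude : ∃ Optimal → Σ (Permutation n n) λ σ → q * + mismatch G (turanAdj k n) (σ ⟨$⟩ʳ_) ≤ N * N
      conclude (σ , opt) = σ , total-mismatch {q} {κ} {N} {+ mismatch G (turanAdj k n) (σ ⟨$⟩ʳ_)} {Err c} {∑ (wrong σ)}
        0≤q 0≤+ Wκ≤N (mismatch≤ G m c σ) err-small (wrong-small {σ} opt (≤-trans 0≤+ 1≤W) classes 1≤κ)
    build : ∃ (Clustered k W) → Σ (Permutation n n) λ σ → q * + mismatch G (turanAdj k n) (σ ⟨$⟩ʳ_) ≤ N * N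
    build (c , C) = conclude c C (Balance.optimum n k c)

-- Translation between rational and integer inequalities

module Rational where

  open Integral using (certify; gap; 0≤+; _⊛_; 0≤sq; *-monoˡ; h₀; threshold; 1≤threshold; turán-stability)
  open import Defs hiding (sym)
  open import Data.Nat.Base as ℕ using (ℕ; suc)
  import Data.Nat.Properties as ℕ
  open import Data.Nat.DivMod using (m≡m%n+[m/n]*n; m%n<n)
  open import Data.Fin.Permutation using (Permutation; _⟨$⟩ʳ_)
  open import Data.Integer.Base as ℤ using (ℤ; +_; 0ℤ; 1ℤ)
  import Data.Integer.Properties as ℤ
  import Data.Integer.Tactic.RingSolver as ℤSolver
  open import Data.Rational as ℚ
  open import Data.Rational.Properties
  import Data.Rational.Unnormalised as ℚᵘ
  import Data.Rational.Unnormalised.Properties as ℚᵘ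
  open import Data.Rational.Solver using (module +-*-Solver)
  open import Data.Product using (Σ; _,_)
  open import Relation.Binary.PropositionalEquality

  ι : ℤ → ℚ
  ι i = i / 1

  toℚᵘ-/ : ∀ i d → toℚᵘ (i / suc d) ℚᵘ.≃ ℚᵘ.mkℚᵘ i d
  toℚᵘ-/ i d = toℚᵘ-fromℚᵘ (ℚᵘ.mkℚᵘ i d)

  ι-+ : ∀ i j → ι (i ℤ.+ j) ≡ ι i + ι j
  ι-+ i j = toℚᵘ-injective (ℚᵘ.≃-trans (toℚᵘ-/ (i ℤ.+ j) 0) (ℚᵘ.≃-sym (ℚᵘ.≃-trans (toℚᵘ-homo-+ (ι i) (ι j))
    (ℚᵘ.≃-trans (ℚᵘ.+-cong (toℚᵘ-/ i 0) (toℚᵘ-/ j 0)) (ℚᵘ.*≡* (eq i j))))))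
    where
    eq : ∀ i j → (i ℤ.* + 1 ℤ.+ j ℤ.* + 1) ℤ.* + 1 ≡ (i ℤ.+ j) ℤ.* + 1
    eq = ℤSolver.solve-∀

  ι-* : ∀ i j → ι (i ℤ.* j) ≡ ι i * ι j
  ι-* i j = toℚᵘ-injective (ℚᵘ.≃-trans (toℚᵘ-/ (i ℤ.* j) 0) (ℚᵘ.≃-sym (ℚᵘ.≃-trans (toℚᵘ-homo-* (ι i) (ι j))
    (ℚᵘ.≃-trans (ℚᵘ.*-cong (toℚᵘ-/ i 0) (toℚᵘ-/ j 0)) (ℚᵘ.*≡* refl)))))

  ι-neg : ∀ i → ι (ℤ.- i) ≡ - ι i
  ι-neg i = toℚᵘ-injective (ℚᵘ.≃-trans (toℚᵘ-/ (ℤ.- i) 0) (ℚᵘ.≃-sym (ℚᵘ.≃-trans (toℚᵘ-homo‿- (ι i))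
    (ℚᵘ.≃-trans (ℚᵘ.-‿cong (toℚᵘ-/ i 0)) (ℚᵘ.*≡* refl)))))

  ι-cancel-≤ : ∀ {i j} → ι i ≤ ι j → i ℤ.≤ j
  ι-cancel-≤ {i} {j} p = subst₂ ℤ._≤_ (ℤ.*-identityʳ i) (ℤ.*-identityʳ j)
    (ℚᵘ.drop-*≤* (ℚᵘ.≤-respʳ-≃ (toℚᵘ-/ j 0) (ℚᵘ.≤-respˡ-≃ (toℚᵘ-/ i 0) (toℚᵘ-mono-≤ p))))

  ι-mono-≤ : ∀ {i j} → i ℤ.≤ j → ι i ≤ ι j
  ι-mono-≤ {i} {j} p = toℚᵘ-cancel-≤ (ℚᵘ.≤-respʳ-≃ (ℚᵘ.≃-sym (toℚᵘ-/ j 0)) (ℚᵘ.≤-respˡ-≃ (ℚᵘ.≃-sym (toℚᵘ-/ i 0))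
    (ℚᵘ.*≤* (subst₂ ℤ._≤_ (sym (ℤ.*-identityʳ i)) (sym (ℤ.*-identityʳ j)) p))))

  ι-*-/ : ∀ i d → ι (+ suc d) * (i / suc d) ≡ ι i
  ι-*-/ i d = toℚᵘ-injective (ℚᵘ.≃-trans (toℚᵘ-homo-* (ι (+ suc d)) (i / suc d))
    (ℚᵘ.≃-trans (ℚᵘ.*-cong (toℚᵘ-/ (+ suc d) 0) (toℚᵘ-/ i d))
    (ℚᵘ.≃-trans (ℚᵘ.*≡* (trans (eq (+ suc d) i) (cong (λ e → i ℤ.* + e) (sym (ℕ.+-identityʳ (suc d)))))) (ℚᵘ.≃-sym (toℚᵘ-/ i 0)))))
    where
    eq : ∀ d i → d ℤ.* i ℤ.* + 1 ≡ i ℤ.* d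
    eq = ℤSolver.solve-∀

  *-monoˡ-ι : ∀ i {p q} → 0ℤ ℤ.≤ i → p ≤ q → ι i * p ≤ ι i * q
  *-monoˡ-ι i 0≤i = *-monoˡ-≤-nonNeg (ι i) {{nonNegative (ι-mono-≤ 0≤i)}}

  ι-sub : ∀ i j → ι (i ℤ.- j) ≡ ι i - ι j
  ι-sub i j = trans (ι-+ i (ℤ.- j)) (cong (λ z → ι i + z) (ι-neg j))

  module _ where
    open +-*-Solver

    -- The ring solver knows no reciprocals: the products k r and E e are kept together as blocks
    -- and replaced by 1 afterwards, here and in `copies-identity`.
    edge-identity : ∀ {k r E e} c → k * r ≡ 1ℚ → E * e ≡ 1ℚ →
      ι (+ 2) * (k * E) * ((1ℚ - r - e) * c) ≡ (k * E - E - k) * (ι (+ 2) * c)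
    edge-identity {k} {r} {E} {e} c kr Ee = trans
      (solve 5 (λ k r E e c → con (ι (+ 2)) :* (k :* E) :* ((con 1ℚ :- r :- e) :* c)
         := (k :* E :- (k :* r) :* E :- k :* (E :* e)) :* (con (ι (+ 2)) :* c)) refl k r E e c)
      (cong₂ (λ x y → (k * E - x - y) * (ι (+ 2) * c)) (trans (cong (_* E) kr) (*-identityˡ E)) (trans (cong (k *_) Ee) (*-identityʳ k)))

    -- Ten labellings per copy turn λ into 10λk⁴, which is the polynomial `h₀`.
    copies-identity : ∀ {k r E e} P → k * r ≡ 1ℚ → E * e ≡ 1ℚ →
      ι (+ 10) * (k * k * (k * k) * E) * ((+ 1 / 10 - + 1 / 2 * r + r * r - r * r * r + + 2 / 5 * r * r * r * r + e) * P)
      ≡ ((k * k * (k * k) - ι (+ 5) * (k * k * k) + ι (+ 10) * (k * k) - ι (+ 10) * k + ι (+ 4)) * E + ι (+ 10) * (k * k * (k * k))) * P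
    copies-identity {k} {r} {E} {e} P kr Ee = trans
      (solve 5 (λ k r E e P →
         con (ι (+ 10)) :* (k :* k :* (k :* k) :* E) :* ((con (+ 1 / 10) :- con (+ 1 / 2) :* r :+ r :* r :- r :* r :* r :+ con (+ 2 / 5) :* r :* r :* r :* r :+ e) :* P)
         := ((k :* k :* (k :* k) :- con (ι (+ 5)) :* (k :* k :* k) :* (k :* r) :+ con (ι (+ 10)) :* (k :* k) :* ((k :* r) :* (k :* r))
              :- con (ι (+ 10)) :* k :* ((k :* r) :* (k :* r) :* (k :* r)) :+ con (ι (+ 4)) :* ((k :* r) :* (k :* r) :* (k :* r) :* (k :* r))) :* E
             :+ con (ι (+ 10)) :* (k :* k :* (k :* k)) :* (E :* e)) :* P) refl k r E e P)
      (trans (cong₂ (λ s t → ((k * k * (k * k) - ι (+ 5) * (k * k * k) * s + ι (+ 10) * (k * k) * (s * s)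
              - ι (+ 10) * k * (s * s * s) + ι (+ 4) * (s * s * s * s)) * E + ι (+ 10) * (k * k * (k * k)) * t) * P) kr Ee)
       (solve 3 (λ k E P →
         ((k :* k :* (k :* k) :- con (ι (+ 5)) :* (k :* k :* k) :* con 1ℚ :+ con (ι (+ 10)) :* (k :* k) :* (con 1ℚ :* con 1ℚ)
              :- con (ι (+ 10)) :* k :* (con 1ℚ :* con 1ℚ :* con 1ℚ) :+ con (ι (+ 4)) :* (con 1ℚ :* con 1ℚ :* con 1ℚ :* con 1ℚ)) :* E
             :+ con (ι (+ 10)) :* (k :* k :* (k :* k)) :* con 1ℚ) :* P
         := ((k :* k :* (k :* k) :- con (ι (+ 5)) :* (k :* k :* k) :+ con (ι (+ 10)) :* (k :* k) :- con (ι (+ 10)) :* k :+ con (ι (+ 4))) :* E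
             :+ con (ι (+ 10)) :* (k :* k :* (k :* k))) :* P) refl k E P))

  0<1/ : ∀ e → 0ℚ < + 1 / suc e
  0<1/ e = toℚᵘ-cancel-< (ℚᵘ.<-respʳ-≃ (ℚᵘ.≃-sym (toℚᵘ-/ (+ 1) e)) (ℚᵘ.*<* (ℤ.+<+ (ℕ.s≤s ℕ.z≤n))))

  positive-suc : ∀ {i} → 1ℤ ℤ.≤ i → Σ ℕ λ e → i ≡ + suc e
  positive-suc {+ suc e} _ = e , refl
  positive-suc {+ 0} (ℤ.+≤+ ())

  1≤↥ : ∀ {δ} → 0ℚ < δ → 1ℤ ℤ.≤ ↥ δ
  1≤↥ {mkℚ (+ suc _) _ _} _ = ℤ.+≤+ (ℕ.s≤s ℕ.z≤n)
  1≤↥ {mkℚ (+ 0) _ _} (*<* (ℤ.+<+ ()))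
  1≤↥ {mkℚ (ℤ.-[1+ _ ]) _ _} (*<* ())

  ι-h₀ : ∀ κ → ι (h₀ κ) ≡ ι κ * ι κ * (ι κ * ι κ) - ι (+ 5) * (ι κ * ι κ * ι κ) + ι (+ 10) * (ι κ * ι κ) - ι (+ 10) * ι κ + ι (+ 4)
  ι-h₀ κ = trans (ι-+ (a ℤ.- b ℤ.+ c ℤ.- + 10 ℤ.* κ) (+ 4)) (cong (_+ ι (+ 4)) (trans (ι-sub (a ℤ.- b ℤ.+ c) (+ 10 ℤ.* κ)) (cong₂ _-_
    (trans (ι-+ (a ℤ.- b) c) (cong₂ _+_ (trans (ι-sub (κ ℤ.* κ ℤ.* (κ ℤ.* κ)) (+ 5 ℤ.* (κ ℤ.* κ ℤ.* κ))) (cong₂ _-_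
      (trans (ι-* (κ ℤ.* κ) (κ ℤ.* κ)) (cong₂ _*_ κκ κκ))
      (trans (ι-* (+ 5) (κ ℤ.* κ ℤ.* κ)) (cong (ι (+ 5) *_) (trans (ι-* (κ ℤ.* κ) κ) (cong (_* ι κ) κκ))))))
      (trans (ι-* (+ 10) (κ ℤ.* κ)) (cong (ι (+ 10) *_) κκ))))
    (ι-* (+ 10) κ))))
    where
    κκ = ι-* κ κ
    a = κ ℤ.* κ ℤ.* (κ ℤ.* κ)
    b = + 5 ℤ.* (κ ℤ.* κ ℤ.* κ)
    c = + 10 ℤ.* (κ ℤ.* κ)

  module Translate (n : ℕ) {κ E : ℤ} {r ε : ℚ} (0≤κ : 0ℤ ℤ.≤ κ) (0≤E : 0ℤ ℤ.≤ E)
                   (kr : ι κ * r ≡ 1ℚ) (Ee : ι E * ε ≡ 1ℚ) where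

    private
      N = + n

    order-large : 1ℚ ≤ ι N * ε → E ℤ.≤ N
    order-large p = ι-cancel-≤ (begin
      ι E                ≡⟨ *-identityʳ (ι E) ⟨
      ι E * 1ℚ           ≤⟨ *-monoˡ-ι E 0≤E p ⟩
      ι E * (ι N * ε)    ≡⟨ solve 3 (λ E N e → E :* (N :* e) := N :* (E :* e)) refl (ι E) (ι N) ε ⟩
      ι N * (ι E * ε)    ≡⟨ trans (cong (ι N *_) Ee) (*-identityʳ (ι N)) ⟩
      ι N                ∎)
      where
      open ≤-Reasoning
      open +-*-Solver

    edges-large : ∀ {ed} → (1ℚ - r - ε) * choose2ℚ n ≤ ι ed → 1 ℕ.≤ n →
      ((κ ℤ.- 1ℤ) ℤ.* E ℤ.- κ) ℤ.* (N ℤ.* (N ℤ.- 1ℤ)) ℤ.≤ + 2 ℤ.* (κ ℤ.* E) ℤ.* ed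
    edges-large {ed} p 1≤n = subst (ℤ._≤ + 2 ℤ.* (κ ℤ.* E) ℤ.* ed) (reshape n 1≤n) (ι-cancel-≤ (begin
      ι ((κ ℤ.* E ℤ.- E ℤ.- κ) ℤ.* + (n ℕ.* (n ℕ.∸ 1)))           ≡⟨ trans (ι-* (κ ℤ.* E ℤ.- E ℤ.- κ) (+ (n ℕ.* (n ℕ.∸ 1)))) (cong₂ _*_
                                                                        (trans (ι-sub (κ ℤ.* E ℤ.- E) κ) (cong (_- ι κ) (trans (ι-sub (κ ℤ.* E) E) (cong (_- ι E) (ι-* κ E)))))
                                                                        (sym (ι-*-/ (+ (n ℕ.* (n ℕ.∸ 1))) 1))) ⟩
      (ι κ * ι E - ι E - ι κ) * (ι (+ 2) * choose2ℚ n)             ≡⟨ edge-identity {ι κ} {r} {ι E} {ε} (choose2ℚ n) kr Ee ⟨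
      ι (+ 2) * (ι κ * ι E) * ((1ℚ - r - ε) * choose2ℚ n)          ≡⟨ cong (_* ((1ℚ - r - ε) * choose2ℚ n)) 2κE ⟨
      ι (+ 2 ℤ.* (κ ℤ.* E)) * ((1ℚ - r - ε) * choose2ℚ n)          ≤⟨ *-monoˡ-ι (+ 2 ℤ.* (κ ℤ.* E)) (0≤+ {2} ⊛ (0≤κ ⊛ 0≤E)) p ⟩
      ι (+ 2 ℤ.* (κ ℤ.* E)) * ι ed                                 ≡⟨ ι-* (+ 2 ℤ.* (κ ℤ.* E)) ed ⟨
      ι (+ 2 ℤ.* (κ ℤ.* E) ℤ.* ed)                                 ∎))
      where
      open ≤-Reasoning
      2κE : ι (+ 2 ℤ.* (κ ℤ.* E)) ≡ ι (+ 2) * (ι κ * ι E)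
      2κE = trans (ι-* (+ 2) (κ ℤ.* E)) (cong (ι (+ 2) *_) (ι-* κ E))
      eq : ∀ κ E M n → (κ ℤ.* E ℤ.- E ℤ.- κ) ℤ.* (M ℤ.* n) ≡ ((κ ℤ.- 1ℤ) ℤ.* E ℤ.- κ) ℤ.* (M ℤ.* n)
      eq = ℤSolver.solve-∀
      reshape : ∀ n → 1 ℕ.≤ n → (κ ℤ.* E ℤ.- E ℤ.- κ) ℤ.* + (n ℕ.* (n ℕ.∸ 1)) ≡ ((κ ℤ.- 1ℤ) ℤ.* E ℤ.- κ) ℤ.* (+ n ℤ.* (+ n ℤ.- 1ℤ))
      reshape (suc n) _ = trans (cong ((κ ℤ.* E ℤ.- E ℤ.- κ) ℤ.*_) (ℤ.pos-* (suc n) n)) (eq κ E (+ suc n) (+ n))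

    copies-small : ∀ L → ι (+ (L ℕ./ 10)) ≤ ((+ 1 / 10 - + 1 / 2 * r + r * r - r * r * r + + 2 / 5 * r * r * r * r) + ε) * (ι N * ι N * ι N * ι N * ι N) →
      κ ℤ.* κ ℤ.* (κ ℤ.* κ) ℤ.* E ℤ.* + L ℤ.≤ (h₀ κ ℤ.* E ℤ.+ + 10 ℤ.* (κ ℤ.* κ ℤ.* (κ ℤ.* κ))) ℤ.* (N ℤ.* N ℤ.* (N ℤ.* N) ℤ.* N) ℤ.+ + 9 ℤ.* (κ ℤ.* κ ℤ.* (κ ℤ.* κ) ℤ.* E)
    copies-small L p = ℤ.≤-trans (*-monoˡ 0≤KE L≤) (ℤ.≤-trans (ℤ.≤-reflexive (eq KE (+ (L ℕ./ 10)))) (ℤ.+-monoˡ-≤ (+ 9 ℤ.* KE) scaled))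
      where
      open ≤-Reasoning
      K = κ ℤ.* κ ℤ.* (κ ℤ.* κ)
      KE = K ℤ.* E
      0≤KE : 0ℤ ℤ.≤ KE
      0≤KE = 0≤sq κ ⊛ 0≤sq κ ⊛ 0≤E
      L≤ : + L ℤ.≤ + 10 ℤ.* + (L ℕ./ 10) ℤ.+ + 9
      L≤ = subst (+ L ℤ.≤_) (cong (ℤ._+ + 9) (ℤ.pos-* 10 (L ℕ./ 10))) (ℤ.+≤+ (ℕ.≤-trans (ℕ.≤-reflexive (m≡m%n+[m/n]*n L 10))
        (ℕ.≤-trans (ℕ.+-monoˡ-≤ _ (ℕ.≤-pred (m%n<n L 10))) (ℕ.≤-reflexive (trans (ℕ.+-comm 9 (L ℕ./ 10 ℕ.* 10)) (cong (ℕ._+ 9) (ℕ.*-comm (L ℕ./ 10) 10)))))))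
      eq : ∀ K c → K ℤ.* (+ 10 ℤ.* c ℤ.+ + 9) ≡ + 10 ℤ.* K ℤ.* c ℤ.+ + 9 ℤ.* K
      eq = ℤSolver.solve-∀
      λε P : ℚ
      λε = + 1 / 10 - + 1 / 2 * r + r * r - r * r * r + + 2 / 5 * r * r * r * r + ε
      P = ι N * ι N * ι N * ι N * ι N
      ιK : ι K ≡ ι κ * ι κ * (ι κ * ι κ)
      ιK = trans (ι-* (κ ℤ.* κ) (κ ℤ.* κ)) (cong₂ _*_ (ι-* κ κ) (ι-* κ κ))
      ιP : ι (N ℤ.* N ℤ.* (N ℤ.* N) ℤ.* N) ≡ P
      ιP = trans (ι-* (N ℤ.* N ℤ.* (N ℤ.* N)) N) (cong (_* ι N) (trans (ι-* (N ℤ.* N) (N ℤ.* N)) (trans (cong₂ _*_ (ι-* N N) (ι-* N N)) (sym (*-assoc (ι N * ι N) (ι N) (ι N))))))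
      scaled : + 10 ℤ.* KE ℤ.* + (L ℕ./ 10) ℤ.≤ (h₀ κ ℤ.* E ℤ.+ + 10 ℤ.* K) ℤ.* (N ℤ.* N ℤ.* (N ℤ.* N) ℤ.* N)
      scaled = ι-cancel-≤ (begin
        ι (+ 10 ℤ.* KE ℤ.* + (L ℕ./ 10))                     ≡⟨ ι-* (+ 10 ℤ.* KE) (+ (L ℕ./ 10)) ⟩
        ι (+ 10 ℤ.* KE) * ι (+ (L ℕ./ 10))                   ≤⟨ *-monoˡ-ι (+ 10 ℤ.* KE) (0≤+ {10} ⊛ 0≤KE) p ⟩
        ι (+ 10 ℤ.* KE) * (λε * P)                           ≡⟨ cong (_* (λε * P)) (trans (ι-* (+ 10) KE) (cong (ι (+ 10) *_) (trans (ι-* K E) (cong (_* ι E) ιK)))) ⟩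
        ι (+ 10) * (ι κ * ι κ * (ι κ * ι κ) * ι E) * (λε * P) ≡⟨ copies-identity {ι κ} {r} {ι E} {ε} P kr Ee ⟩
        ((ι κ * ι κ * (ι κ * ι κ) - ι (+ 5) * (ι κ * ι κ * ι κ) + ι (+ 10) * (ι κ * ι κ) - ι (+ 10) * ι κ + ι (+ 4)) * ι E + ι (+ 10) * (ι κ * ι κ * (ι κ * ι κ))) * P
          ≡⟨ cong₂ (λ a b → (a * ι E + b) * P) (ι-h₀ κ) (trans (ι-* (+ 10) K) (cong (ι (+ 10) *_) ιK)) ⟨
        (ι (h₀ κ) * ι E + ι (+ 10 ℤ.* K)) * P                ≡⟨ cong₂ _*_ (trans (ι-+ (h₀ κ ℤ.* E) (+ 10 ℤ.* K)) (cong (_+ ι (+ 10 ℤ.* K)) (ι-* (h₀ κ) E))) ιP ⟨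
        ι (h₀ κ ℤ.* E ℤ.+ + 10 ℤ.* K) * ι (N ℤ.* N ℤ.* (N ℤ.* N) ℤ.* N) ≡⟨ ι-* (h₀ κ ℤ.* E ℤ.+ + 10 ℤ.* K) (N ℤ.* N ℤ.* (N ℤ.* N) ℤ.* N) ⟨
        ι ((h₀ κ ℤ.* E ℤ.+ + 10 ℤ.* K) ℤ.* (N ℤ.* N ℤ.* (N ℤ.* N) ℤ.* N)) ∎)

  -- A positive δ has numerator at least 1, hence is at least the reciprocal of its denominator; so
  -- q = ↧ δ suffices.
  distance-small : ∀ {δ} N mis → 0ℚ < δ → ↧ δ ℤ.* mis ℤ.≤ N ℤ.* N → ι mis ≤ δ * (ι N * ι N)
  distance-small {δ} N mis 0<δ p = *-cancelˡ-≤-pos (ι (↧ δ)) {{positive (<-≤-trans (0<1/ 0) (ι-mono-≤ {+ 1} {↧ δ} (ℤ.+≤+ (ℕ.s≤s ℕ.z≤n))))}} (begin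
    ι (↧ δ) * ι mis             ≡⟨ ι-* (↧ δ) mis ⟨
    ι (↧ δ ℤ.* mis)             ≤⟨ ι-mono-≤ (ℤ.≤-trans p N²≤) ⟩
    ι (↥ δ ℤ.* (N ℤ.* N))       ≡⟨ trans (ι-* (↥ δ) (N ℤ.* N)) (cong₂ _*_ (sym ↧δ*δ) (ι-* N N)) ⟩
    ι (↧ δ) * δ * (ι N * ι N)   ≡⟨ *-assoc (ι (↧ δ)) δ (ι N * ι N) ⟩
    ι (↧ δ) * (δ * (ι N * ι N)) ∎)
    where
    open ≤-Reasoning
    ↧δ*δ : ι (↧ δ) * δ ≡ ι (↥ δ)
    ↧δ*δ = trans (cong (ι (↧ δ) *_) (sym (↥p/↧p≡p δ))) (ι-*-/ (↥ δ) (ℚ.denominator-1 δ))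
    eq : ∀ a M → a ℤ.* M ℤ.- M ≡ (a ℤ.- 1ℤ) ℤ.* M
    eq = ℤSolver.solve-∀
    N²≤ : N ℤ.* N ℤ.≤ ↥ δ ℤ.* (N ℤ.* N)
    N²≤ = certify (eq (↥ δ) (N ℤ.* N)) (gap (1≤↥ 0<δ) ⊛ 0≤sq N)

  module _ (m e : ℕ) (3≤k : 3 ℕ.≤ suc m) (δ : ℚ) (0<δ : 0ℚ < δ) (E≡ : threshold (suc m) (↧ δ) ≡ + suc e)
           {n : ℕ} (G : Graph n) where
    private
      k = suc m
      r = recipℕ k
      ε = + 1 / suc e
      kr : ι (+ k) * r ≡ 1ℚ
      kr = ι-*-/ (+ 1) m
      Ee : ι (+ suc e) * ε ≡ 1ℚ
      Ee = ι-*-/ (+ 1) e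
    open Translate n {+ k} {+ suc e} {r} {ε} 0≤+ 0≤+ kr Ee

    turán-close : 1ℚ ≤ ℕtoℚ n * ε → (1ℚ - r - ε) * choose2ℚ n ≤ ℕtoℚ (edges G) →
      ℕtoℚ (copiesC5 G) ≤ ((+ 1 / 10 - + 1 / 2 * r + r * r - r * r * r + + 2 / 5 * r * r * r * r) + ε)
        * (ℕtoℚ n * ℕtoℚ n * ℕtoℚ n * ℕtoℚ n * ℕtoℚ n) →
      withinEditDistTuran k G (δ * (ℕtoℚ n * ℕtoℚ n))
    turán-close large many few = conclude (turán-stability m G (↧ δ) (ℤ.+≤+ 3≤k) (ℤ.+≤+ (ℕ.s≤s ℕ.z≤n)) {+ suc e} E≡ E≤N
        (edges-large {+ edges G} many (ℕ.≤-trans (ℕ.s≤s ℕ.z≤n) (ℤ.drop‿+≤+ E≤N))) (copies-small (labelledC5 G) few))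
      where
      E≤N : + suc e ℤ.≤ + n
      E≤N = order-large large
      conclude : (Σ (Permutation n n) λ σ → ↧ δ ℤ.* + mismatch G (turanAdj k n) (σ ⟨$⟩ʳ_) ℤ.≤ + n ℤ.* + n) →
        withinEditDistTuran k G (δ * (ℕtoℚ n * ℕtoℚ n))
      conclude (σ , close) = σ , distance-small {δ} (+ n) (+ mismatch G (turanAdj k n) (σ ⟨$⟩ʳ_)) 0<δ close

  threshold-suc : ∀ k δ → Σ ℕ λ e → threshold k (↧ δ) ≡ + suc e
  threshold-suc k δ = positive-suc (1≤threshold k (ℤ.+≤+ (ℕ.s≤s ℕ.z≤n)))

open import Defs
open import Data.Nat using (ℕ; _≤_)
open import Data.Integer using (+_)
open import Data.Rational using (ℚ; _/_; _*_; _+_; _-_; 1ℚ; 0ℚ; _<_) renaming (_≤_ to _≤ℚ_)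
open import Data.Product using (Σ; _×_)
open import Data.Nat using (suc)
open import Data.Product using (_,_)
open import Relation.Binary.PropositionalEquality using (_≡_)
open Integral using (threshold)
open Rational using (turán-close; threshold-suc; 0<1/)

theorem2 : (k : ℕ) → 3 ≤ k →
    (δ : ℚ) → 0ℚ < δ →
    Σ ℚ λ ε → 0ℚ < ε ×
    ((n : ℕ) → (G : Graph n) →
    1ℚ ≤ℚ ℕtoℚ n * ε →
    (1ℚ - recipℕ k - ε) * choose2ℚ n ≤ℚ ℕtoℚ (edges G) →
    ℕtoℚ (copiesC5 G)
    ≤ℚ ((+ 1 / 10 - + 1 / 2 * recipℕ k + recipℕ k * recipℕ k
    - recipℕ k * recipℕ k * recipℕ k
    + + 2 / 5 * recipℕ k * recipℕ k * recipℕ k * recipℕ k)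
    + ε) * (ℕtoℚ n * ℕtoℚ n * ℕtoℚ n * ℕtoℚ n * ℕtoℚ n) →
    withinEditDistTuran k G (δ * (ℕtoℚ n * ℕtoℚ n)))
theorem2 (suc m) 3≤k δ 0<δ = choose (threshold-suc (suc m) δ)
  where
  choose : (Σ ℕ λ e → threshold (suc m) (Data.Rational.↧ δ) ≡ + suc e) → _
  -- With ε the reciprocal of the threshold E, the condition 1 ≤ nε says exactly E ≤ n. The
  -- successor form of E makes the fraction well formed.
  choose (e , E≡) = + 1 / suc e , 0<1/ e , λ n G → turán-close m e 3≤k δ 0<δ E≡ G
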